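{- Let $m\ge1$. There exists a unique compact magic hypercube of order $4$ and dimension $m$ (with entries $1,\ldots,4^m$) up to the natural faithful action of the group $\mathrm{Aut}(FQ_{2m})\cong C_2^{2m}\rtimes S_{2m+1}$; that is, the set of such hypercubes is nonempty and forms a single orbit under this faithful action.
   Context: A compact magic hypercube of order $4$ and dimension $m$ is an arrangement of the numbers $1,2,\ldots,4^m$ in a $4\times\cdots\times4$ ($m$-fold) grid, with positions indexed by $(\mathbb Z/4\mathbb Z)^m$, such that all orthogonal lines (four positions obtained by fixing all but one coordinate) and all $2\times2$ subsquares (positions obtained by fixing all but two coordinates and letting those two range over $\{i,i+1\}\times\{k,k+1\}$ modulo $4$, so wrap-around subsquares are included) sum to the same magic constant. $Q_{2m}$ is the hypercube graph on $\{0,1\}^{2m}$, and the folded hypercube graph $FQ_{2m}$ is $Q_{2m}$ together with an edge joining each pair of antipodal vertices (vertices differing in all coordinates). $C_4^m$ is the $m$-fold Cartesian product of the $4$-cycle $C_4$, i.e. the toroidal grid graph on the positions; since $C_4\cong K_2\times K_2$, there is a graph isomorphism $C_4^m\cong Q_{2m}$, which is fixed. The natural action is: $\mathrm{Aut}(FQ_{2m})$ permutes the vertices of $FQ_{2m}$, which are the vertices of $Q_{2m}$, hence via the isomorphism permutes the positions $(\mathbb Z/4\mathbb Z)^m$ of the grid, and thus acts on arrangements. In $C_2^{2m}\rtimes S_{2m+1}$, $C_2^{2m}$ is identified with $\mathbb F_2^{2m+1}/\langle e_0+\cdots+e_{2m}\rangle$ and $S_{2m+1}$ permutes $e_0,\ldots,e_{2m}$.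 -}

module Defs where

open import Level using (0ℓ)
open import Algebra.Bundles using (Group; CommutativeRing)
open import Algebra.Morphism.Structures using (IsGroupIsomorphism)
import Algebra.Properties.CommutativeSemigroup as CommutativeSemigroupProperties
import Algebra.Properties.Group as GroupProperties
open import Data.Bool.Base using (Bool; true; false; _xor_)
import Data.Bool.Properties as Bool
open import Data.Empty using (⊥-elim)
open import Data.Fin.Base using (Fin; zero; suc; toℕ)
open import Data.Fin.Patterns using (0F; 1F; 2F; 3F)
open import Data.Fin.Permutation as Perm using (Permutation′; _⟨$⟩ʳ_; _⟨$⟩ˡ_)
import Data.Fin.Properties as Fin
open import Data.Nat.Base using (ℕ; zero; suc; _+_; _*_; _^_)
open import Data.Nat.DivMod using (_mod_)
open import Data.Product using (_×_; _,_; ∃-syntax)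
open import Data.Sum.Base using (_⊎_; inj₁; inj₂)
open import Data.Vec.Base using (Vec; []; _∷_; head; tail; lookup; _[_]≔_)
import Data.Vec.Relation.Binary.Pointwise.Extensional as Ext
open import Function.Base using (_∘_)
open import Function.Bundles using (_↔_; mk↔ₛ′; Inverse; _⇔_; mk⇔; Equivalence)
open import Function.Construct.Composition using (_↔-∘_; _⇔-∘_)
open import Function.Construct.Identity using (↔-id; ⇔-id)
open import Function.Construct.Symmetry using (↔-sym; ⇔-sym)
open import Relation.Binary.Bundles using (Setoid)
open import Relation.Binary.PropositionalEquality
open import Relation.Nullary.Decidable using (from-yes; _×-dec_; _⊎-dec_; _→-dec_; ¬?)

open Inverse using (to; from; strictlyInverseˡ; strictlyInverseʳ)

_≅ᴳ_ : Group 0ℓ 0ℓ → Group 0ℓ 0ℓ → Set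
G ≅ᴳ H = ∃[ f ] IsGroupIsomorphism (Group.rawGroup G) (Group.rawGroup H) f

record LeftAction (G : Group 0ℓ 0ℓ) (S : Setoid 0ℓ 0ℓ) : Set where
  private
    module G = Group G
    module S = Setoid S
  infixr 8 _▷_
  field
    _▷_        : G.Carrier → S.Carrier → S.Carrier
    ▷-cong     : ∀ {g h x y} → g G.≈ h → x S.≈ y → (g ▷ x) S.≈ (h ▷ y)
    ▷-identity : ∀ x → (G.ε ▷ x) S.≈ x
    ▷-assoc    : ∀ g h x → ((g G.∙ h) ▷ x) S.≈ (g ▷ h ▷ x)

module _ {G : Group 0ℓ 0ℓ} {S : Setoid 0ℓ 0ℓ} (α : LeftAction G S)
         (P : Setoid.Carrier S → Set) where
  private
    module G = Group G
    module S = Setoid S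
    open LeftAction α

  Stable : Set
  Stable = ∀ g x → P x → P (g ▷ x)

  FaithfulOn : Set
  FaithfulOn = ∀ g → (∀ x → P x → (g ▷ x) S.≈ x) → g G.≈ G.ε

  TransitiveOn : Set
  TransitiveOn = ∀ x y → P x → P y → ∃[ g ] (g ▷ x) S.≈ y

record ActionByAutomorphisms (H N : Group 0ℓ 0ℓ) : Set where
  field
    action : LeftAction H (Group.setoid N)
  open LeftAction action public
  open Group N
  field
    ▷-distrib-∙ : ∀ h x y → (h ▷ (x ∙ y)) ≈ ((h ▷ x) ∙ (h ▷ y))

module _ (N H : Group 0ℓ 0ℓ) (α : ActionByAutomorphisms H N) where
  private
    module N = Group N
    module H = Group H
    open ActionByAutomorphisms α

    ▷-ε : ∀ h → (h ▷ N.ε) N.≈ N.ε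
    ▷-ε h = GroupProperties.identityˡ-unique N _ (h ▷ N.ε)
      (N.trans (N.sym (▷-distrib-∙ h N.ε N.ε)) (▷-cong H.refl (N.identityˡ N.ε)))

  semidirectProduct : Group 0ℓ 0ℓ
  semidirectProduct = record
    { Carrier = N.Carrier × H.Carrier
    ; _≈_     = λ (n , h) (n′ , h′) → n N.≈ n′ × h H.≈ h′
    ; _∙_     = λ (n , h) (n′ , h′) → n N.∙ (h ▷ n′) , h H.∙ h′
    ; ε       = N.ε , H.ε
    ; _⁻¹     = λ (n , h) → (h H.⁻¹) ▷ (n N.⁻¹) , h H.⁻¹
    ; isGroup = record
      { isMonoid = record
        { isSemigroup = record
          { isMagma = record
            { isEquivalence = record
              { refl  = N.refl , H.refl
              ; sym   = λ (p , q) → N.sym p , H.sym q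
              ; trans = λ (p , q) (p′ , q′) → N.trans p p′ , H.trans q q′
              }
            ; ∙-cong = λ (p , q) (p′ , q′) → N.∙-cong p (▷-cong q p′) , H.∙-cong q q′
            }
          ; assoc = λ (n₁ , h₁) (n₂ , h₂) (n₃ , h₃) →
                N.trans (N.assoc n₁ (h₁ ▷ n₂) ((h₁ H.∙ h₂) ▷ n₃))
                  (N.∙-congˡ (N.trans (N.∙-congˡ (▷-assoc h₁ h₂ n₃))
                                      (N.sym (▷-distrib-∙ h₁ n₂ (h₂ ▷ n₃)))))
              , H.assoc h₁ h₂ h₃
          }
        ; identity =
            (λ (n , h) → N.trans (N.identityˡ _) (▷-identity n) , H.identityˡ h)
          , (λ (n , h) → N.trans (N.∙-congˡ (▷-ε h)) (N.identityʳ n) , H.identityʳ h)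
        }
      ; inverse =
          (λ (n , h) →
              N.trans (N.sym (▷-distrib-∙ (h H.⁻¹) (n N.⁻¹) n))
                (N.trans (▷-cong H.refl (N.inverseˡ n)) (▷-ε (h H.⁻¹)))
            , H.inverseˡ h)
        , (λ (n , h) →
              N.trans (N.∙-congˡ (N.trans (N.sym (▷-assoc h (h H.⁻¹) (n N.⁻¹)))
                        (N.trans (▷-cong (H.inverseʳ h) N.refl) (▷-identity (n N.⁻¹)))))
                      (N.inverseʳ n)
            , H.inverseʳ h)
      ; ⁻¹-cong = λ (p , q) → ▷-cong (H.⁻¹-cong q) (N.⁻¹-cong p) , H.⁻¹-cong q
      }
    }

-- σ ∙ τ = "first τ, then σ"
symmetricGroup : ℕ → Group 0ℓ 0ℓ
symmetricGroup k = record
  { Carrier = Permutation′ k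
  ; _≈_     = Perm._≈_
  ; _∙_     = λ σ τ → σ ↔-∘ τ
  ; ε       = Perm.id
  ; _⁻¹     = Perm.flip
  ; isGroup = record
    { isMonoid = record
      { isSemigroup = record
        { isMagma = record
          { isEquivalence = record
            { refl  = λ _ → refl
            ; sym   = λ p i → sym (p i)
            ; trans = λ p q i → trans (p i) (q i)
            }
          ; ∙-cong = λ {σ} {σ′} {τ} p q i → trans (p (τ ⟨$⟩ʳ i)) (cong (σ′ ⟨$⟩ʳ_) (q i))
          }
        ; assoc = λ _ _ _ _ → refl
        }
      ; identity = (λ _ _ → refl) , (λ _ _ → refl)
      }
    ; inverse = (λ σ _ → Perm.inverseˡ σ) , (λ σ _ → Perm.inverseʳ σ)
    ; ⁻¹-cong = λ {σ} {τ} p → from-cong σ τ p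
    }
  }
  where
  from-cong : ∀ (σ τ : Permutation′ k) → σ Perm.≈ τ → ∀ i → σ ⟨$⟩ˡ i ≡ τ ⟨$⟩ˡ i
  from-cong σ τ p i =
    trans (cong (σ ⟨$⟩ˡ_) (sym (trans (p (τ ⟨$⟩ˡ i)) (Perm.inverseʳ τ))))
          (Perm.inverseˡ σ)

-- 𝔽₂ᵏ / ⟨e₀ + ⋯ + eₖ₋₁⟩: vectors are identified when their difference is
-- constantly c, i.e. is c · (e₀ + ⋯ + eₖ₋₁)
𝔽₂^_/⟨1⟩ : ℕ → Group 0ℓ 0ℓ
𝔽₂^ k /⟨1⟩ = record
  { Carrier = Fin k → Bool
  ; _≈_     = λ x y → ∃[ c ] ∀ i → x i ≡ y i xor c
  ; _∙_     = λ x y i → x i xor y i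
  ; ε       = λ _ → false
  ; _⁻¹     = λ x → x
  ; isGroup = record
    { isMonoid = record
      { isSemigroup = record
        { isMagma = record
          { isEquivalence = record
            { refl  = false , λ i → sym (Bool.xor-identityʳ _)
            ; sym   = λ (c , p) → c , λ i → sym (trans (cong (_xor c) (p i)) (cancel _ c))
            ; trans = λ {_} {_} {z} (c , p) (d , q) → (d xor c) , λ i →
                trans (p i) (trans (cong (_xor c) (q i)) (Bool.xor-assoc (z i) d c))
            }
          ; ∙-cong = λ {_} {y} {_} {v} (c , p) (d , q) → (c xor d) , λ i →
              trans (cong₂ _xor_ (p i) (q i)) (interchange (y i) c (v i) d)
          }
        ; assoc = λ x y z → false , λ i →
            trans (Bool.xor-assoc (x i) (y i) (z i)) (sym (Bool.xor-identityʳ _))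
        }
      ; identity = (λ x → false , λ i → sym (Bool.xor-identityʳ _))
                 , (λ x → false , λ i → refl)
      }
    ; inverse = (λ x → false , λ i → Bool.xor-same (x i))
              , (λ x → false , λ i → Bool.xor-same (x i))
    ; ⁻¹-cong = λ p → p
    }
  }
  where
  cancel : ∀ a c → (a xor c) xor c ≡ a
  cancel a c = trans (Bool.xor-assoc a c c)
    (trans (cong (a xor_) (Bool.xor-same c)) (Bool.xor-identityʳ a))

  open CommutativeSemigroupProperties
    (CommutativeRing.+-commutativeSemigroup Bool.xor-∧-commutativeRing)
    using (interchange)

-- σ sends e_i to e_{σ i}, so (σ ▷ x)_i = x_{σ⁻¹ i}
permuteBasis : ∀ k → ActionByAutomorphisms (symmetricGroup k) (𝔽₂^ k /⟨1⟩)
permuteBasis k = record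
  { action = record
    { _▷_        = λ σ x i → x (σ ⟨$⟩ˡ i)
    ; ▷-cong     = λ {σ} {τ} {x} {y} p (c , q) → c , λ i →
        trans (q (σ ⟨$⟩ˡ i))
              (cong (λ j → y j xor c) (Group.⁻¹-cong (symmetricGroup k) {σ} {τ} p i))
    ; ▷-identity = λ x → false , λ i → sym (Bool.xor-identityʳ _)
    ; ▷-assoc    = λ σ τ x → false , λ i → sym (Bool.xor-identityʳ _)
    }
  ; ▷-distrib-∙ = λ σ x y → false , λ i → sym (Bool.xor-identityʳ _)
  }

-- C₂ᵏ ⋊ S_{k+1}, with C₂ᵏ realised as 𝔽₂ᵏ⁺¹ / ⟨e₀ + ⋯ + eₖ⟩
C₂^_⋊S : ℕ → Group 0ℓ 0ℓ
C₂^ k ⋊S =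
  semidirectProduct (𝔽₂^ suc k /⟨1⟩) (symmetricGroup (suc k)) (permuteBasis (suc k))

-- Irreflexivity is not a field: every graph below is loopless except the
-- degenerate FQ 0.
record Graph : Set₁ where
  field
    Vertex  : Set
    Adj     : Vertex → Vertex → Set
    Adj-sym : ∀ {x y} → Adj x y → Adj y x

open Graph

record GraphIso (G H : Graph) : Set where
  field
    vertices : Vertex G ↔ Vertex H
    adjacent : ∀ x y → Adj G x y ⇔ Adj H (to vertices x) (to vertices y)

open GraphIso

infixr 9 _∘ᵍ_

_∘ᵍ_ : ∀ {G H K} → GraphIso H K → GraphIso G H → GraphIso G K
ψ ∘ᵍ φ = record
  { vertices = vertices ψ ↔-∘ vertices φ
  ; adjacent = λ x y →
      adjacent ψ (to (vertices φ) x) (to (vertices φ) y) ⇔-∘ adjacent φ x y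
  }

idᵍ : ∀ {G} → GraphIso G G
idᵍ = record { vertices = ↔-id _ ; adjacent = λ _ _ → ⇔-id _ }

symᵍ : ∀ {G H} → GraphIso G H → GraphIso H G
symᵍ {G} {H} φ = record
  { vertices = ↔-sym (vertices φ)
  ; adjacent = λ x y → ⇔-sym
      (subst₂ (λ u v → Adj G (from (vertices φ) x) (from (vertices φ) y) ⇔ Adj H u v)
              (strictlyInverseˡ (vertices φ) x) (strictlyInverseˡ (vertices φ) y)
              (adjacent φ _ _))
  }

Aut : Graph → Group 0ℓ 0ℓ
Aut G = record
  { Carrier = GraphIso G G
  ; _≈_     = λ f g → ∀ x → to (vertices f) x ≡ to (vertices g) x
  ; _∙_     = _∘ᵍ_
  ; ε       = idᵍ
  ; _⁻¹     = symᵍ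
  ; isGroup = record
    { isMonoid = record
      { isSemigroup = record
        { isMagma = record
          { isEquivalence = record
            { refl  = λ _ → refl
            ; sym   = λ p x → sym (p x)
            ; trans = λ p q x → trans (p x) (q x)
            }
          ; ∙-cong = λ {f} {f′} {g} p q x →
              trans (p (to (vertices g) x)) (cong (to (vertices f′)) (q x))
          }
        ; assoc = λ _ _ _ _ → refl
        }
      ; identity = (λ _ _ → refl) , (λ _ _ → refl)
      }
    ; inverse = (λ f → strictlyInverseʳ (vertices f)) , (λ f → strictlyInverseˡ (vertices f))
    ; ⁻¹-cong = λ {f} {g} p x →
        trans (cong (from (vertices f))
                    (sym (trans (p (from (vertices g) x)) (strictlyInverseˡ (vertices g) x))))
              (strictlyInverseʳ (vertices f) (from (vertices g) x))
    }
  }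

infixl 8 _□^_

_□^_ : Graph → ℕ → Graph
G □^ n = record
  { Vertex  = Vec (Vertex G) n
  ; Adj     = λ x y → ∃[ i ] Adj G (lookup x i) (lookup y i)
                           × (∀ j → j ≢ i → lookup x j ≡ lookup y j)
  ; Adj-sym = λ (i , e , p) → i , Adj-sym G e , λ j j≢i → sym (p j j≢i)
  }

K₂ : Graph
K₂ = record { Vertex = Bool ; Adj = _≢_ ; Adj-sym = λ p → p ∘ sym }

Q : ℕ → Graph
Q n = K₂ □^ n

Antipodal : ∀ {n} → Vec Bool n → Vec Bool n → Set
Antipodal x y = ∀ i → lookup x i ≢ lookup y i

FQ : ℕ → Graph
FQ n = record
  { Vertex  = Vec Bool n
  ; Adj     = λ x y → Adj (Q n) x y ⊎ Antipodal x y
  ; Adj-sym = λ {x} {y} → λ where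
      (inj₁ e) → inj₁ (Adj-sym (Q n) {x} {y} e)
      (inj₂ a) → inj₂ λ i → a i ∘ sym
  }

infix 10 _+1
_+1 : Fin 4 → Fin 4
a +1 = suc (toℕ a) mod 4

C₄ : Graph
C₄ = record
  { Vertex  = Fin 4
  ; Adj     = λ a b → b ≡ a +1 ⊎ a ≡ b +1
  ; Adj-sym = λ where
      (inj₁ e) → inj₂ e
      (inj₂ e) → inj₁ e
  }

Position : ℕ → Set
Position m = Vec (Fin 4) m

Arrangement : ℕ → Set
Arrangement m = Position m ↔ Fin (4 ^ m)

entry : ∀ {m} → Arrangement m → Position m → ℕ
entry A p = suc (toℕ (to A p))

lineSum : ∀ {m} → Arrangement m → Position m → Fin m → ℕ
lineSum A p i = at 0F + at 1F + at 2F + at 3F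
  where
  at : Fin 4 → ℕ
  at a = entry A (p [ i ]≔ a)

squareSum : ∀ {m} → Arrangement m → Position m → Fin m → Fin m → Fin 4 → Fin 4 → ℕ
squareSum A p i j a b = at a b + at a (b +1) + at (a +1) b + at (a +1) (b +1)
  where
  at : Fin 4 → Fin 4 → ℕ
  at a b = entry A (p [ i ]≔ a [ j ]≔ b)

IsCompactMagic : ∀ {m} → Arrangement m → Set
IsCompactMagic A = ∃[ c ]
    (∀ p i → lineSum A p i ≡ c)
  × (∀ p i j → i ≢ j → ∀ a b → squareSum A p i j a b ≡ c)

arrangements : ℕ → Setoid 0ℓ 0ℓ
arrangements m = record
  { Carrier = Arrangement m
  ; _≈_     = λ A B → ∀ p → entry A p ≡ entry B p
  ; isEquivalence = record
    { refl  = λ _ → refl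
    ; sym   = λ p x → sym (p x)
    ; trans = λ p q x → trans (p x) (q x)
    }
  }

permutePositions : ∀ {m} → GraphIso (C₄ □^ m) (Q (m * 2)) →
                   GraphIso (FQ (m * 2)) (FQ (m * 2)) → Position m ↔ Position m
permutePositions φ g = ↔-sym (vertices φ) ↔-∘ (vertices g ↔-∘ vertices φ)

-- The entry at position p is moved to position g p.
naturalAction : ∀ {m} → GraphIso (C₄ □^ m) (Q (m * 2)) →
                LeftAction (Aut (FQ (m * 2))) (arrangements m)
naturalAction {m} φ = record
  { _▷_        = λ g A → A ↔-∘ ↔-sym (permutePositions φ g)
  ; ▷-cong     = λ {g} {h} {A} {B} g≈h A≈B p →
      trans (A≈B _) (cong (entry B ∘ from (vertices φ))
                          (Group.⁻¹-cong (Aut (FQ (m * 2))) {g} {h} g≈h _))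
  ; ▷-identity = λ A p → cong (entry A) (strictlyInverseʳ (vertices φ) p)
  ; ▷-assoc    = λ g h A p → cong (entry A ∘ from (vertices φ) ∘ from (vertices h))
      (sym (strictlyInverseˡ (vertices φ) _))
  }

-- One coordinate at a time, via the Gray code C₄ ≅ K₂ □ K₂.

private
  □-cons : ∀ (G : Graph) {n} x y (xs ys : Vec (Vertex G) n) →
           Adj (G □^ suc n) (x ∷ xs) (y ∷ ys) ⇔
           ((Adj G x y × xs ≡ ys) ⊎ (x ≡ y × Adj (G □^ n) xs ys))
  □-cons G {n} x y xs ys = mk⇔ ⇒ ⇐
    where
    ⇒ : Adj (G □^ suc n) (x ∷ xs) (y ∷ ys) →
        (Adj G x y × xs ≡ ys) ⊎ (x ≡ y × Adj (G □^ n) xs ys)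
    ⇒ (zero  , e , p) =
      inj₁ (e , Ext.Pointwise-≡⇒≡ (Ext.ext λ j → p (suc j) λ ()))
    ⇒ (suc i , e , p) =
      inj₂ (p zero (λ ()) , i , e , λ j j≢i → p (suc j) (j≢i ∘ Fin.suc-injective))

    ⇐ : (Adj G x y × xs ≡ ys) ⊎ (x ≡ y × Adj (G □^ n) xs ys) →
        Adj (G □^ suc n) (x ∷ xs) (y ∷ ys)
    ⇐ (inj₁ (e , refl)) = zero , e , λ where
      zero    0≢0 → ⊥-elim (0≢0 refl)
      (suc j) _   → refl
    ⇐ (inj₂ (refl , i , e , p)) = suc i , e , λ where
      zero    _    → refl
      (suc j) j≢si → p j (j≢si ∘ cong suc)

  bit₁ bit₂ : Fin 4 → Bool
  bit₁ 0F = false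
  bit₁ 1F = false
  bit₁ 2F = true
  bit₁ 3F = true
  bit₂ 0F = false
  bit₂ 1F = true
  bit₂ 2F = true
  bit₂ 3F = false

  bits⁻¹ : Bool → Bool → Fin 4
  bits⁻¹ false false = 0F
  bits⁻¹ false true  = 1F
  bits⁻¹ true  true  = 2F
  bits⁻¹ true  false = 3F

  bits⁻¹-bits : ∀ a → bits⁻¹ (bit₁ a) (bit₂ a) ≡ a
  bits⁻¹-bits 0F = refl
  bits⁻¹-bits 1F = refl
  bits⁻¹-bits 2F = refl
  bits⁻¹-bits 3F = refl

  bit₁-bits⁻¹ : ∀ s t → bit₁ (bits⁻¹ s t) ≡ s
  bit₁-bits⁻¹ false false = refl
  bit₁-bits⁻¹ false true  = refl
  bit₁-bits⁻¹ true  true  = refl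
  bit₁-bits⁻¹ true  false = refl

  bit₂-bits⁻¹ : ∀ s t → bit₂ (bits⁻¹ s t) ≡ t
  bit₂-bits⁻¹ false false = refl
  bit₂-bits⁻¹ false true  = refl
  bit₂-bits⁻¹ true  true  = refl
  bit₂-bits⁻¹ true  false = refl

  BitAdj : Fin 4 → Fin 4 → Set
  BitAdj a b = (bit₁ a ≢ bit₁ b × bit₂ a ≡ bit₂ b) ⊎ (bit₁ a ≡ bit₁ b × bit₂ a ≢ bit₂ b)

  C₄⇒Bit : ∀ a b → Adj C₄ a b → BitAdj a b
  C₄⇒Bit = from-yes (Fin.all? λ a → Fin.all? λ b →
    ((b Fin.≟ a +1) ⊎-dec (a Fin.≟ b +1)) →-dec
    ((¬? (bit₁ a Bool.≟ bit₁ b) ×-dec (bit₂ a Bool.≟ bit₂ b)) ⊎-dec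
     ((bit₁ a Bool.≟ bit₁ b) ×-dec ¬? (bit₂ a Bool.≟ bit₂ b))))

  Bit⇒C₄ : ∀ a b → BitAdj a b → Adj C₄ a b
  Bit⇒C₄ = from-yes (Fin.all? λ a → Fin.all? λ b →
    ((¬? (bit₁ a Bool.≟ bit₁ b) ×-dec (bit₂ a Bool.≟ bit₂ b)) ⊎-dec
     ((bit₁ a Bool.≟ bit₁ b) ×-dec ¬? (bit₂ a Bool.≟ bit₂ b))) →-dec
    ((b Fin.≟ a +1) ⊎-dec (a Fin.≟ b +1)))

  bits-injective : ∀ a b → bit₁ a ≡ bit₁ b → bit₂ a ≡ bit₂ b → a ≡ b
  bits-injective a b p q =
    trans (sym (bits⁻¹-bits a)) (trans (cong₂ bits⁻¹ p q) (bits⁻¹-bits b))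

C₄^m≅Q₂ₘ : ∀ m → GraphIso (C₄ □^ m) (Q (m * 2))
C₄^m≅Q₂ₘ m = record
  { vertices = mk↔ₛ′ (f {m}) (g {m}) (f-g {m}) g-f
  ; adjacent = λ p q → mk⇔ (⇒ p q) (⇐ p q)
  }
  where
  f : ∀ {m} → Vec (Fin 4) m → Vec Bool (m * 2)
  f []      = []
  f (a ∷ p) = bit₁ a ∷ bit₂ a ∷ f p

  g : ∀ {m} → Vec Bool (m * 2) → Vec (Fin 4) m
  g {zero}  []          = []
  g {suc m} (s ∷ t ∷ v) = bits⁻¹ s t ∷ g v

  f-g : ∀ {m} v → f (g {m} v) ≡ v
  f-g {zero}  []          = refl
  f-g {suc m} (s ∷ t ∷ v) =
    cong₂ _∷_ (bit₁-bits⁻¹ s t) (cong₂ _∷_ (bit₂-bits⁻¹ s t) (f-g {m} v))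

  g-f : ∀ {m} (p : Vec (Fin 4) m) → g (f p) ≡ p
  g-f []      = refl
  g-f (a ∷ p) = cong₂ _∷_ (bits⁻¹-bits a) (g-f p)

  f-injective : ∀ {m} (p q : Vec (Fin 4) m) → f p ≡ f q → p ≡ q
  f-injective p q e = trans (sym (g-f p)) (trans (cong g e) (g-f q))

  open Equivalence renaming (to to ⟶; from to ⟵)

  ⇒ : ∀ {m} (p q : Vec (Fin 4) m) → Adj (C₄ □^ m) p q → Adj (Q (m * 2)) (f p) (f q)
  ⇒ []      []      (() , _)
  ⇒ (a ∷ p) (b ∷ q) e with ⟶ (□-cons C₄ a b p q) e
  ... | inj₂ (refl , e′) =
    ⟵ (□-cons K₂ _ _ _ _) (inj₂ (refl , ⟵ (□-cons K₂ _ _ _ _) (inj₂ (refl , ⇒ p q e′))))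
  ... | inj₁ (e′ , refl) with C₄⇒Bit a b e′
  ...   | inj₁ (d , s) = ⟵ (□-cons K₂ _ _ _ _) (inj₁ (d , cong (_∷ f p) s))
  ...   | inj₂ (s , d) =
    ⟵ (□-cons K₂ _ _ _ _) (inj₂ (s , ⟵ (□-cons K₂ _ _ _ _) (inj₁ (d , refl))))

  ⇐ : ∀ {m} (p q : Vec (Fin 4) m) → Adj (Q (m * 2)) (f p) (f q) → Adj (C₄ □^ m) p q
  ⇐ []      []      (() , _)
  ⇐ (a ∷ p) (b ∷ q) e with ⟶ (□-cons K₂ _ _ _ _) e
  ... | inj₁ (d , r) = ⟵ (□-cons C₄ a b p q)
    (inj₁ ( Bit⇒C₄ a b (inj₁ (d , cong head r))
          , f-injective p q (cong tail r)))
  ... | inj₂ (s , e′) with ⟶ (□-cons K₂ _ _ _ _) e′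
  ...   | inj₁ (d , r) = ⟵ (□-cons C₄ a b p q)
    (inj₁ (Bit⇒C₄ a b (inj₂ (s , d)) , f-injective p q r))
  ...   | inj₂ (t , e″) = ⟵ (□-cons C₄ a b p q)
    (inj₂ (bits-injective a b s t , ⇐ p q e″))

{-# OPTIONS --safe #-}
module Submission where

-- Every vertex of FQ 2m is a class of 𝔽₂²ᵐ⁺¹/⟨1⟩ and contains exactly one even
-- vector y.  Write H for the entries, centred and doubled.  An arrangement is
-- compact magic iff H sums to 0 over all 4-cycles of FQ 2m, also those through
-- antipodes; hence automorphisms preserve compact magic arrangements, and
-- 2H = Σᵢ dᵢ (-1)^(yᵢ) for some d₀, …, d₂ₘ.  The values of H are symmetric about 0,
-- which forces some dᵢ = 0; then the subset sums of the other |dᵢ| / 2 are exactly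
-- 0, …, 4ᵐ - 1, which forces these weights to be 1, 2, 4, …, 2²ᵐ⁻¹ in some order.  So
-- up to a translation (the signs) and a permutation of the yᵢ (the order), the
-- entries are the binary expansions of (y₁, …, y₂ₘ).

open import Data.Nat using (ℕ; _*_; _≤_)
open import Data.Product using (_×_; ∃-syntax)
open import Defs

open import Algebra.Bundles using (CommutativeRing; Group)
import Algebra.Properties.CommutativeMonoid.Sum as Sum
import Algebra.Properties.Group as GroupProperties
open import Data.Bool.Base using (Bool; true; false; not; _xor_)
import Data.Bool.Properties as Bool
import Data.Bool.Solver as BoolSolver
open import Data.Empty using (⊥; ⊥-elim)
open import Data.Fin.Base
  using (Fin; zero; suc; toℕ; fromℕ<; cast; combine; opposite; punchIn; punchOut)
open import Data.Fin.Patterns using (0F; 1F; 2F; 3F)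
open import Data.Fin.Permutation
  using (Permutation′; _⟨$⟩ʳ_; _⟨$⟩ˡ_; cast-id; flip; insert; inverseˡ; inverseʳ; permutation; reverse)
import Data.Fin.Permutation as Perm
import Data.Fin.Properties as Fin
open import Data.Integer.Base as ℤ using (ℤ; +_; -[1+_]; ∣_∣)
import Data.Integer.Properties as ℤ
import Data.Integer.Solver as ℤSolver
open import Data.Nat.Base as ℕ using (zero; suc; _^_; _<_)
import Data.Nat.Properties as ℕ
import Data.Nat.Solver as ℕSolver
open import Data.Product using (_,_; Σ-syntax; proj₁; proj₂)
open import Data.Product.Function.NonDependent.Propositional using (_×-↔_)
open import Data.Sum.Base as Sum⊎ using (_⊎_; inj₁; inj₂)
open import Data.Vec.Base
  using (Vec; []; _∷_; _[_]≔_; lookup; replicate; tabulate; updateAt)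
open import Data.Vec.Functional using (insertAt; removeAt)
open import Data.Vec.Functional.Properties
  using (insertAt-lookup; insertAt-punchIn; removeAt-insertAt)
import Data.Vec.Properties as Vec
import Data.Vec.Relation.Binary.Pointwise.Extensional as Ext
open import Function.Base using (_∘_)
open import Function.Bundles using (_↔_; mk↔ₛ′; Inverse; mk⇔; Equivalence)
open import Function.Construct.Composition using (_↔-∘_)
open import Function.Construct.Symmetry using (↔-sym)
open import Relation.Binary.PropositionalEquality
open import Relation.Nullary using (yes; no)
open import Relation.Nullary.Decidable using (from-yes; _×-dec_; _⊎-dec_; _→-dec_; ¬?)

open ≡-Reasoning

-- Evenness of 2m makes the antipodal direction one among equals. The all-ones vector of 𝔽₂²ᵐ⁺¹ has
-- odd weight, so passing to even vectors turns equality of classes into equality of vectors, and a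
-- step in any of the 2m + 1 directions j toggles every coordinate of y except the j-th. In
-- particular two different steps determine their unordered pair of directions, without exceptions
-- for small m. Since φ is an arbitrary isomorphism, being magic has to be expressed in terms that φ
-- preserves: lines and squares together are the 4-cycles of the torus. Centring makes the common
-- sum 0; doubling keeps the values integral. The sum of H over an edge in direction i is then
-- determined by i up to sign. Its value at the origin is dᵢ, and (-1)^(yᵢ) is the sign. The
-- remaining obstacle is that the 2m + 1 signs are tied by the parity of y. Once some dᵢ vanishes,
-- its coordinate absorbs the parity, the other 2m signs vary freely, and the values become subset
-- sums.

module Σ₂ = Sum (CommutativeRing.+-commutativeMonoid Bool.xor-∧-commutativeRing)

-- Vectors over 𝔽₂: parity and unit vectors

par : ∀ {n} → (Fin n → Bool) → Bool
par = Σ₂.sum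

xor-cancelˡ : ∀ a {b c} → a xor b ≡ a xor c → b ≡ c
xor-cancelˡ false e = e
xor-cancelˡ true  e = Bool.not-injective e

δ : ∀ {n} → Fin n → Fin n → Bool
δ zero    zero    = true
δ zero    (suc j) = false
δ (suc i) zero    = false
δ (suc i) (suc j) = δ i j

δ-refl : ∀ {n} (i : Fin n) → δ i i ≡ true
δ-refl zero    = refl
δ-refl (suc i) = δ-refl i

δ-≢ : ∀ {n} {i j : Fin n} → i ≢ j → δ i j ≡ false
δ-≢ {i = zero}  {zero}  i≢j = ⊥-elim (i≢j refl)
δ-≢ {i = zero}  {suc j} i≢j = refl
δ-≢ {i = suc i} {zero}  i≢j = refl
δ-≢ {i = suc i} {suc j} i≢j = δ-≢ (i≢j ∘ cong suc)

δ⇒≡ : ∀ {n} (i j : Fin n) → δ i j ≡ true → i ≡ j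
δ⇒≡ zero    zero    _ = refl
δ⇒≡ (suc i) (suc j) e = cong suc (δ⇒≡ i j e)

δ-injective : ∀ {n} {i j : Fin n} → (∀ x → δ i x ≡ δ j x) → i ≡ j
δ-injective {i = i} {j} e = sym (δ⇒≡ j i (trans (sym (e i)) (δ-refl i)))

δ-permute : ∀ {n} (σ : Permutation′ n) i j → δ (σ ⟨$⟩ʳ i) j ≡ δ i (σ ⟨$⟩ˡ j)
δ-permute σ i j with i Fin.≟ σ ⟨$⟩ˡ j
... | yes refl = trans (cong (λ k → δ k j) (inverseʳ σ))
                       (trans (δ-refl j) (sym (δ-refl (σ ⟨$⟩ˡ j))))
... | no i≢ = trans (δ-≢ λ e → i≢ (trans (sym (inverseˡ σ)) (cong (σ ⟨$⟩ˡ_) e)))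
                    (sym (δ-≢ i≢))

-- As i ≢ j, the left side is `true` at i, so one of k and l must be i; cancelling it leaves an
-- equality of unit vectors.
δ-pairs : ∀ {n} {i j k l : Fin n} → i ≢ j → (∀ x → δ i x xor δ j x ≡ δ k x xor δ l x) →
          (i ≡ k × j ≡ l) ⊎ (i ≡ l × j ≡ k)
δ-pairs {i = i} {j} {k} {l} i≢j e with k Fin.≟ i | l Fin.≟ i
... | yes refl | _ = inj₁ (refl , δ-injective λ x → xor-cancelˡ (δ k x) (e x))
... | no _ | yes refl = inj₂ (refl , δ-injective λ x →
  xor-cancelˡ (δ l x) (trans (e x) (Bool.xor-comm (δ k x) (δ l x))))
... | no k≢i | no l≢i = ⊥-elim (absurd (begin
  true                ≡⟨ cong₂ _xor_ (δ-refl i) (δ-≢ (i≢j ∘ sym)) ⟨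
  δ i i xor δ j i     ≡⟨ e i ⟩
  δ k i xor δ l i     ≡⟨ cong₂ _xor_ (δ-≢ k≢i) (δ-≢ l≢i) ⟩
  false               ∎))
  where
  absurd : true ≢ false
  absurd ()

par-δ : ∀ {n} (i : Fin n) → par (δ i) ≡ true
par-δ {suc n} zero    = cong not (Σ₂.sum-replicate-zero n)
par-δ {suc n} (suc i) = par-δ i

-- The 2m + 1 equal entries cancel in pairs and leave one. This is where evenness of the dimension
-- of the cube enters.
par-const : ∀ m c → par {suc (m ℕ.* 2)} (λ _ → c) ≡ c
par-const zero    c = Bool.xor-identityʳ c
par-const (suc m) c = trans (cong (λ p → c xor (c xor p)) (par-const m c))
  (trans (cong (c xor_) (Bool.xor-same c)) (Bool.xor-identityʳ c))

lookup-injective : ∀ {A : Set} {n} {v w : Vec A n} → (∀ i → lookup v i ≡ lookup w i) → v ≡ w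
lookup-injective e = Ext.Pointwise-≡⇒≡ (Ext.ext e)

flip-induction : ∀ {n} (P : Vec Bool n → Set) → (∀ v i → P v → P (updateAt v i not)) →
                 ∀ v w → P v → P w
flip-induction P step []      []      p = p
flip-induction P step (a ∷ v) (b ∷ w) p
  with a Bool.≟ b | flip-induction (P ∘ (a ∷_)) (λ v i → step (a ∷ v) (suc i)) v w p
... | yes refl | p′ = p′
... | no a≢b   | p′ = subst (λ c → P (c ∷ w)) (sym (Bool.¬-not (a≢b ∘ sym))) (step (a ∷ w) zero p′)

-- The folded cube as the Cayley graph of 𝔽₂ⁿ⁺¹/⟨1⟩ on e₀, ..., eₙ

module FoldedCube (m : ℕ) where

  open BoolSolver.xor-∧-Solver using (solve; _:=_; _:+_; con)

  n : ℕ
  n = m ℕ.* 2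

  V : Set
  V = Vec Bool n

  𝟎 : V
  𝟎 = replicate n false

  -- The representative whose coordinate `zero` is cleared; `q` clears it by adding `u zero` times
  -- the all-ones vector. Since e₀ is congruent to e₁ + ⋯ + eₙ, direction `zero` is the antipodal
  -- one.
  ℓ : V → Fin (suc n) → Bool
  ℓ v = lookup (false ∷ v)

  q : (Fin (suc n) → Bool) → V
  q u = tabulate λ i → u (suc i) xor u zero

  -- Since n + 1 is odd, each class of 𝔽₂ⁿ⁺¹/⟨1⟩ contains exactly one vector of
  -- even weight; y v is the one representing v.
  y : V → Fin (suc n) → Bool
  y v i = ℓ v i xor par (ℓ v)

  infixl 8 _•_

  abstract
    ℓ-𝟎 : ∀ i → ℓ 𝟎 i ≡ false
    ℓ-𝟎 zero    = refl
    ℓ-𝟎 (suc i) = Vec.lookup-replicate i false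

    q-cong : ∀ {u w} → (∀ i → u i ≡ w i) → q u ≡ q w
    q-cong e = Vec.tabulate-cong λ i → cong₂ _xor_ (e (suc i)) (e zero)

    ℓ-q : ∀ u i → ℓ (q u) i ≡ u i xor u zero
    ℓ-q u zero    = sym (Bool.xor-same (u zero))
    ℓ-q u (suc i) = Vec.lookup∘tabulate _ i

    q-ℓ : ∀ v → q (ℓ v) ≡ v
    q-ℓ v = trans (Vec.tabulate-cong λ i → Bool.xor-identityʳ _) (Vec.tabulate∘lookup v)

    par-ℓ-q : ∀ u → par (ℓ (q u)) ≡ par u xor u zero
    par-ℓ-q u = begin
      par (ℓ (q u))                          ≡⟨ Σ₂.sum-cong-≗ (ℓ-q u) ⟩
      par (λ i → u i xor u zero)             ≡⟨ Σ₂.∑-distrib-+ u (λ _ → u zero) ⟩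
      par u xor par {suc n} (λ _ → u zero)   ≡⟨ cong (par u xor_) (par-const m (u zero)) ⟩
      par u xor u zero                       ∎

    y-q : ∀ u i → y (q u) i ≡ u i xor par u
    y-q u i = trans (cong₂ _xor_ (ℓ-q u i) (par-ℓ-q u))
      (solve 3 (λ a b c → (a :+ b) :+ (c :+ b) := a :+ c) refl (u i) (u zero) (par u))

    y-injective : ∀ {v w} → (∀ i → y v i ≡ y w i) → v ≡ w
    y-injective {v} {w} e = lookup-injective λ i →
      xor-cancelˡ (par (ℓ v)) (begin
        par (ℓ v) xor lookup v i   ≡⟨ Bool.xor-comm (par (ℓ v)) _ ⟩
        y v (suc i)                ≡⟨ e (suc i) ⟩
        y w (suc i)                ≡⟨ Bool.xor-comm (lookup w i) _ ⟩
        par (ℓ w) xor lookup w i   ≡⟨ cong (_xor lookup w i) (e zero) ⟨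
        par (ℓ v) xor lookup w i   ∎)

    par-y : ∀ v → par (y v) ≡ false
    par-y v = begin
      par (y v)                                      ≡⟨ Σ₂.∑-distrib-+ (ℓ v) (λ _ → par (ℓ v)) ⟩
      par (ℓ v) xor par {suc n} (λ _ → par (ℓ v))    ≡⟨ cong (par (ℓ v) xor_) (par-const m _) ⟩
      par (ℓ v) xor par (ℓ v)                        ≡⟨ Bool.xor-same (par (ℓ v)) ⟩
      false                                          ∎

    y-𝟎 : ∀ i → y 𝟎 i ≡ false
    y-𝟎 i = cong₂ _xor_ (ℓ-𝟎 i) (trans (Σ₂.sum-cong-≗ ℓ-𝟎) (par-const m false))

    _•_ : V → Fin (suc n) → V
    v • j = q (λ i → ℓ v i xor δ j i)

    -- Adding eⱼ makes the weight odd; adding the all-ones vector restores an even weight. Together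
    -- they toggle every coordinate but j.
    y-• : ∀ v j i → y (v • j) i ≡ y v i xor not (δ j i)
    y-• v j i = begin
      y (v • j) i
        ≡⟨ y-q (λ k → ℓ v k xor δ j k) i ⟩
      (ℓ v i xor δ j i) xor par (λ k → ℓ v k xor δ j k)
        ≡⟨ cong ((ℓ v i xor δ j i) xor_) (trans (Σ₂.∑-distrib-+ (ℓ v) (δ j)) (cong (par (ℓ v) xor_) (par-δ j))) ⟩
      (ℓ v i xor δ j i) xor (par (ℓ v) xor true)
        ≡⟨ solve 3 (λ a b c → (a :+ b) :+ (c :+ con true) := (a :+ c) :+ (con true :+ b)) refl (ℓ v i) (δ j i) (par (ℓ v)) ⟩
      y v i xor not (δ j i) ∎

    y-•• : ∀ v i j x → y (v • i • j) x ≡ y v x xor (δ i x xor δ j x)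
    y-•• v i j x = begin
      y (v • i • j) x                                  ≡⟨ y-• (v • i) j x ⟩
      y (v • i) x xor not (δ j x)                      ≡⟨ cong (_xor not (δ j x)) (y-• v i x) ⟩
      (y v x xor not (δ i x)) xor not (δ j x)
        ≡⟨ solve 3 (λ a b c → (a :+ (con true :+ b)) :+ (con true :+ c) := a :+ (b :+ c)) refl (y v x) (δ i x) (δ j x) ⟩
      y v x xor (δ i x xor δ j x)                      ∎

    •-involutive : ∀ v i → v • i • i ≡ v
    •-involutive v i = y-injective λ x → trans (y-•• v i i x)
      (trans (cong (y v x xor_) (Bool.xor-same (δ i x))) (Bool.xor-identityʳ _))

    •-comm : ∀ v i j → v • i • j ≡ v • j • i
    •-comm v i j = y-injective λ x → trans (y-•• v i j x)
      (trans (cong (y v x xor_) (Bool.xor-comm (δ i x) (δ j x))) (sym (y-•• v j i x)))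

    •-injective : ∀ v {i j} → v • i ≡ v • j → i ≡ j
    •-injective v {i} {j} e = δ-injective λ x → Bool.not-injective
      (xor-cancelˡ (y v x) (trans (sym (y-• v i x)) (trans (cong (λ w → y w x) e) (y-• v j x))))

    •-cancel : ∀ v {i j} → v • i • j ≡ v → i ≡ j
    •-cancel v {i} {j} e = •-injective v
      (trans (sym (•-involutive (v • i) j)) (cong (_• j) e))

    -- Equal vertices have equal even vectors, not just congruent ones, so `δ-pairs` applies
    -- literally.
    •-pairs : ∀ v {i j k l} → i ≢ j → v • i • j ≡ v • k • l → (i ≡ k × j ≡ l) ⊎ (i ≡ l × j ≡ k)
    •-pairs v {i} {j} {k} {l} i≢j e = δ-pairs i≢j λ x → xor-cancelˡ (y v x)
      (trans (sym (y-•• v i j x)) (trans (cong (λ w → y w x) e) (y-•• v k l x)))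

    lookup-•0 : ∀ v i → lookup (v • zero) i ≡ not (lookup v i)
    lookup-•0 v i = trans (Vec.lookup∘tabulate _ i)
      (solve 1 (λ a → (a :+ con false) :+ con true := con true :+ a) refl (lookup v i))

    lookup-•suc : ∀ v j i → lookup (v • suc j) i ≡ lookup v i xor δ j i
    lookup-•suc v j i = trans (Vec.lookup∘tabulate _ i) (Bool.xor-identityʳ _)

    •suc≡updateAt : ∀ v i → v • suc i ≡ updateAt v i not
    •suc≡updateAt v i = lookup-injective λ j → trans (lookup-•suc v i j) (lemma j)
      where
      lemma : ∀ j → lookup v j xor δ i j ≡ lookup (updateAt v i not) j
      lemma j with j Fin.≟ i
      ... | yes refl = trans (cong (lookup v j xor_) (δ-refl j))
        (trans (Bool.xor-comm _ true) (sym (Vec.lookup∘updateAt j v)))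
      ... | no j≢i = trans (cong (lookup v j xor_) (δ-≢ (j≢i ∘ sym)))
        (trans (Bool.xor-identityʳ _) (sym (Vec.lookup∘updateAt′ j i j≢i v)))

    -- The edges of `Q n` connect all vertices. An invariant carried along them can then be read off
    -- at `v • zero`, which compares the antipodal direction with the others.
    •-induction : (P : V → Set) → (∀ v i → P v → P (v • suc i)) → ∀ v w → P v → P w
    •-induction P step = flip-induction P λ v i → subst P (•suc≡updateAt v i) ∘ step v i

    •⇒Q-adj : ∀ v i → Graph.Adj (Q n) v (v • suc i)
    •⇒Q-adj v i = i
      , (λ e → Bool.not-¬ refl (sym (trans (sym (trans (lookup-•suc v i i)
          (trans (cong (lookup v i xor_) (δ-refl i)) (Bool.xor-comm _ true)))) (sym e))))
      , λ j j≢i → sym (trans (lookup-•suc v i j)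
          (trans (cong (lookup v j xor_) (δ-≢ (j≢i ∘ sym))) (Bool.xor-identityʳ _)))

    Q-adj⇒• : ∀ {v w} → Graph.Adj (Q n) v w → ∃[ i ] w ≡ v • suc i
    Q-adj⇒• {v} {w} (i , d , s) = i , lookup-injective λ j → trans (lemma j) (sym (lookup-•suc v i j))
      where
      lemma : ∀ j → lookup w j ≡ lookup v j xor δ i j
      lemma j with j Fin.≟ i
      ... | yes refl = trans (Bool.¬-not (d ∘ sym))
        (trans (Bool.xor-comm true _) (cong (lookup v j xor_) (sym (δ-refl j))))
      ... | no j≢i = trans (sym (s j j≢i)) (sym
        (trans (cong (lookup v j xor_) (δ-≢ (j≢i ∘ sym))) (Bool.xor-identityʳ _)))

    FQ-adj⇒• : ∀ {v w} → Graph.Adj (FQ n) v w → ∃[ i ] w ≡ v • i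
    FQ-adj⇒• {v} {w} (inj₁ e) with i , p ← Q-adj⇒• {v} {w} e = suc i , p
    FQ-adj⇒• {v} (inj₂ a) = zero , lookup-injective λ i →
      trans (Bool.¬-not (a i ∘ sym)) (sym (lookup-•0 v i))

    •⇒FQ-adj : ∀ v i → Graph.Adj (FQ n) v (v • i)
    •⇒FQ-adj v zero    = inj₂ λ i e → Bool.not-¬ refl (trans e (lookup-•0 v i))
    •⇒FQ-adj v (suc i) = inj₁ (•⇒Q-adj v i)

  -- The affine maps x ↦ u + σ x as automorphisms

  act : (Fin (suc n) → Bool) → Permutation′ (suc n) → V → V
  act u σ v = q λ i → u i xor ℓ v (σ ⟨$⟩ˡ i)

  abstract
    -- Permuting coordinates preserves weight, so only u needs correcting: u + `par u` is the even
    -- vector of its class.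
    y-act : ∀ u σ v i → y (act u σ v) i ≡ (u i xor par u) xor y v (σ ⟨$⟩ˡ i)
    y-act u σ v i = begin
      y (act u σ v) i
        ≡⟨ y-q (λ j → u j xor ℓ v (σ ⟨$⟩ˡ j)) i ⟩
      (u i xor ℓ v (σ ⟨$⟩ˡ i)) xor par (λ j → u j xor ℓ v (σ ⟨$⟩ˡ j))
        ≡⟨ cong ((u i xor ℓ v (σ ⟨$⟩ˡ i)) xor_) (trans (Σ₂.∑-distrib-+ u (λ j → ℓ v (σ ⟨$⟩ˡ j)))
             (cong (par u xor_) (sym (Σ₂.sum-permute (ℓ v) (flip σ))))) ⟩
      (u i xor ℓ v (σ ⟨$⟩ˡ i)) xor (par u xor par (ℓ v))
        ≡⟨ solve 4 (λ a b c d → (a :+ b) :+ (c :+ d) := (a :+ c) :+ (b :+ d)) refl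
             (u i) (ℓ v (σ ⟨$⟩ˡ i)) (par u) (par (ℓ v)) ⟩
      (u i xor par u) xor y v (σ ⟨$⟩ˡ i) ∎

    act-• : ∀ u σ v j → act u σ (v • j) ≡ act u σ v • (σ ⟨$⟩ʳ j)
    act-• u σ v j = y-injective λ i → begin
      y (act u σ (v • j)) i
        ≡⟨ y-act u σ (v • j) i ⟩
      (u i xor par u) xor y (v • j) (σ ⟨$⟩ˡ i)
        ≡⟨ cong ((u i xor par u) xor_) (y-• v j (σ ⟨$⟩ˡ i)) ⟩
      (u i xor par u) xor (y v (σ ⟨$⟩ˡ i) xor not (δ j (σ ⟨$⟩ˡ i)))
        ≡⟨ Bool.xor-assoc (u i xor par u) _ _ ⟨
      ((u i xor par u) xor y v (σ ⟨$⟩ˡ i)) xor not (δ j (σ ⟨$⟩ˡ i))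
        ≡⟨ cong₂ (λ a b → a xor not b) (y-act u σ v i) (δ-permute σ j i) ⟨
      y (act u σ v) i xor not (δ (σ ⟨$⟩ʳ j) i)
        ≡⟨ y-• (act u σ v) (σ ⟨$⟩ʳ j) i ⟨
      y (act u σ v • (σ ⟨$⟩ʳ j)) i ∎

    act-∘ : ∀ u σ w τ v → act u σ (act w τ v) ≡
            act (λ i → u i xor w (σ ⟨$⟩ˡ i)) (Group._∙_ (symmetricGroup (suc n)) σ τ) v
    act-∘ u σ w τ v = y-injective λ i → begin
      y (act u σ (act w τ v)) i
        ≡⟨ y-act u σ (act w τ v) i ⟩
      (u i xor par u) xor y (act w τ v) (σ ⟨$⟩ˡ i)
        ≡⟨ cong ((u i xor par u) xor_) (y-act w τ v (σ ⟨$⟩ˡ i)) ⟩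
      (u i xor par u) xor ((w (σ ⟨$⟩ˡ i) xor par w) xor y v (τ ⟨$⟩ˡ (σ ⟨$⟩ˡ i)))
        ≡⟨ solve 5 (λ a b c d e → (a :+ b) :+ ((c :+ d) :+ e) := ((a :+ c) :+ (b :+ d)) :+ e) refl
             (u i) (par u) (w (σ ⟨$⟩ˡ i)) (par w) (y v (τ ⟨$⟩ˡ (σ ⟨$⟩ˡ i))) ⟩
      ((u i xor w (σ ⟨$⟩ˡ i)) xor (par u xor par w)) xor y v (τ ⟨$⟩ˡ (σ ⟨$⟩ˡ i))
        ≡⟨ cong (λ p → ((u i xor w (σ ⟨$⟩ˡ i)) xor p) xor y v (τ ⟨$⟩ˡ (σ ⟨$⟩ˡ i)))
             (trans (Σ₂.∑-distrib-+ u (λ j → w (σ ⟨$⟩ˡ j))) (cong (par u xor_) (sym (Σ₂.sum-permute w (flip σ))))) ⟨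
      ((u i xor w (σ ⟨$⟩ˡ i)) xor par (λ j → u j xor w (σ ⟨$⟩ˡ j))) xor y v (τ ⟨$⟩ˡ (σ ⟨$⟩ˡ i))
        ≡⟨ y-act (λ j → u j xor w (σ ⟨$⟩ˡ j)) (Group._∙_ (symmetricGroup (suc n)) σ τ) v i ⟨
      y (act (λ j → u j xor w (σ ⟨$⟩ˡ j)) (Group._∙_ (symmetricGroup (suc n)) σ τ) v) i ∎

  module _ (u : Fin (suc n) → Bool) (σ : Permutation′ (suc n)) where

    -- The inverse x ↦ σ⁻¹ u + σ⁻¹ x; the vector σ⁻¹ u has i-th coordinate `u (σ ⟨$⟩ʳ i)`.
    act⁻¹ : V → V
    act⁻¹ = act (u ∘ (σ ⟨$⟩ʳ_)) (flip σ)

    abstract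
      private
        par-u : par (u ∘ (σ ⟨$⟩ʳ_)) ≡ par u
        par-u = sym (Σ₂.sum-permute u σ)

        cancel : ∀ a b c → (a xor b) xor ((a xor b) xor c) ≡ c
        cancel = solve 3 (λ a b c → (a :+ b) :+ ((a :+ b) :+ c) := c) refl

      act⁻¹-act : ∀ v → act⁻¹ (act u σ v) ≡ v
      act⁻¹-act v = y-injective λ i → begin
        y (act⁻¹ (act u σ v)) i
          ≡⟨ y-act (u ∘ (σ ⟨$⟩ʳ_)) (flip σ) (act u σ v) i ⟩
        (u (σ ⟨$⟩ʳ i) xor par (u ∘ (σ ⟨$⟩ʳ_))) xor y (act u σ v) (σ ⟨$⟩ʳ i)
          ≡⟨ cong₂ (λ p z → (u (σ ⟨$⟩ʳ i) xor p) xor z) par-u (y-act u σ v (σ ⟨$⟩ʳ i)) ⟩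
        (u (σ ⟨$⟩ʳ i) xor par u) xor ((u (σ ⟨$⟩ʳ i) xor par u) xor y v (σ ⟨$⟩ˡ (σ ⟨$⟩ʳ i)))
          ≡⟨ cancel (u (σ ⟨$⟩ʳ i)) (par u) _ ⟩
        y v (σ ⟨$⟩ˡ (σ ⟨$⟩ʳ i))
          ≡⟨ cong (y v) (inverseˡ σ) ⟩
        y v i ∎

      act-act⁻¹ : ∀ v → act u σ (act⁻¹ v) ≡ v
      act-act⁻¹ v = y-injective λ i → begin
        y (act u σ (act⁻¹ v)) i
          ≡⟨ y-act u σ (act⁻¹ v) i ⟩
        (u i xor par u) xor y (act⁻¹ v) (σ ⟨$⟩ˡ i)
          ≡⟨ cong ((u i xor par u) xor_) (y-act (u ∘ (σ ⟨$⟩ʳ_)) (flip σ) v (σ ⟨$⟩ˡ i)) ⟩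
        (u i xor par u) xor ((u (σ ⟨$⟩ʳ (σ ⟨$⟩ˡ i)) xor par (u ∘ (σ ⟨$⟩ʳ_))) xor y v (σ ⟨$⟩ʳ (σ ⟨$⟩ˡ i)))
          ≡⟨ cong₂ (λ j p → (u i xor par u) xor ((u j xor p) xor y v j)) (inverseʳ σ) par-u ⟩
        (u i xor par u) xor ((u i xor par u) xor y v i)
          ≡⟨ cancel (u i) (par u) _ ⟩
        y v i ∎

  abstract
    act-adj : ∀ u σ {v w} → Graph.Adj (FQ n) v w → Graph.Adj (FQ n) (act u σ v) (act u σ w)
    act-adj u σ {v} {w} e = move (FQ-adj⇒• {v} {w} e)
      where
      move : ∃[ j ] w ≡ v • j → Graph.Adj (FQ n) (act u σ v) (act u σ w)
      move (j , refl) = subst (Graph.Adj (FQ n) (act u σ v)) (sym (act-• u σ v j)) (•⇒FQ-adj (act u σ v) (σ ⟨$⟩ʳ j))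

  automorphism : (Fin (suc n) → Bool) → Permutation′ (suc n) → GraphIso (FQ n) (FQ n)
  automorphism u σ = record
    { vertices = mk↔ₛ′ (act u σ) (act⁻¹ u σ) (act-act⁻¹ u σ) (act⁻¹-act u σ)
    ; adjacent = λ v w → mk⇔ (act-adj u σ {v} {w}) λ e →
        subst₂ (Graph.Adj (FQ n)) (act⁻¹-act u σ v) (act⁻¹-act u σ w)
               (act-adj (u ∘ (σ ⟨$⟩ʳ_)) (flip σ) {act u σ v} {act u σ w} e)
    }

  -- Every automorphism is affine

  module Automorphism (g : GraphIso (FQ n) (FQ n)) where
    open Inverse (GraphIso.vertices g)

    private
      step : ∀ v i → ∃[ j ] to (v • i) ≡ to v • j
      step v i = FQ-adj⇒• {to v} {to (v • i)}
        (Equivalence.to (GraphIso.adjacent g v (v • i)) (•⇒FQ-adj v i))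

      dir : V → Fin (suc n) → Fin (suc n)
      dir v i = proj₁ (step v i)

      to-injective : ∀ {v w} → to v ≡ to w → v ≡ w
      to-injective {v} {w} e = trans (sym (strictlyInverseʳ v)) (trans (cong from e) (strictlyInverseʳ w))

      to-•• : ∀ v i j → to (v • i • j) ≡ to v • dir v i • dir (v • i) j
      to-•• v i j = trans (proj₂ (step (v • i) j)) (cong (_• dir (v • i) j) (proj₂ (step v i)))

      dir-injective : ∀ v {i j} → dir v i ≡ dir v j → i ≡ j
      dir-injective v {i} {j} e = •-injective v (to-injective
        (trans (proj₂ (step v i)) (trans (cong (to v •_) e) (sym (proj₂ (step v j))))))

      -- The 4-cycle v, v • i, v • i • j, v • j is mapped to a 4-cycle, whose
      -- opposite edges have the same direction.
      dir-const : ∀ v j i → dir (v • j) i ≡ dir v i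
      dir-const v j i with i Fin.≟ j
      ... | yes refl = sym (•-cancel (to v) (trans (sym (to-•• v i i)) (cong to (•-involutive v i))))
      ... | no i≢j with •-pairs (to v)
              (λ e → i≢j (sym (•-cancel v (to-injective (trans (to-•• v j i)
                (trans (cong (to v • dir v j •_) (sym e)) (•-involutive (to v) (dir v j))))))))
              (trans (sym (to-•• v j i)) (trans (cong to (•-comm v j i)) (to-•• v i j)))
      ...   | inj₁ (e , _) = ⊥-elim (i≢j (dir-injective v (sym e)))
      ...   | inj₂ (_ , e) = e

      dir-𝟎 : ∀ v i → dir v i ≡ dir 𝟎 i
      dir-𝟎 v i = •-induction (λ v → dir v i ≡ dir 𝟎 i) (λ v j → trans (dir-const v (suc j) i)) 𝟎 v refl

    to-• : ∀ v i → to (v • i) ≡ to v • dir 𝟎 i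
    to-• v i = trans (proj₂ (step v i)) (cong (to v •_) (dir-𝟎 v i))

    translation : Fin (suc n) → Bool
    translation = ℓ (to 𝟎)

    direction : Fin (suc n) → Fin (suc n)
    direction = dir 𝟎

    direction-injective : ∀ {i j} → direction i ≡ direction j → i ≡ j
    direction-injective = dir-injective 𝟎

  module _ (g : GraphIso (FQ n) (FQ n)) where
    open Inverse (GraphIso.vertices g)
    private
      module g   = Automorphism g
      module g⁻¹ = Automorphism (symᵍ g)

      direction⁻¹-direction : ∀ i → g⁻¹.direction (g.direction i) ≡ i
      direction⁻¹-direction i = •-injective 𝟎 (begin
        𝟎 • g⁻¹.direction (g.direction i)            ≡⟨ cong (_• g⁻¹.direction (g.direction i)) (strictlyInverseʳ 𝟎) ⟨
        from (to 𝟎) • g⁻¹.direction (g.direction i)  ≡⟨ g⁻¹.to-• (to 𝟎) (g.direction i) ⟨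
        from (to 𝟎 • g.direction i)                  ≡⟨ cong from (g.to-• 𝟎 i) ⟨
        from (to (𝟎 • i))                            ≡⟨ strictlyInverseʳ (𝟎 • i) ⟩
        𝟎 • i                                        ∎)

      direction-direction⁻¹ : ∀ i → g.direction (g⁻¹.direction i) ≡ i
      direction-direction⁻¹ i = •-injective 𝟎 (begin
        𝟎 • g.direction (g⁻¹.direction i)            ≡⟨ cong (_• g.direction (g⁻¹.direction i)) (strictlyInverseˡ 𝟎) ⟨
        to (from 𝟎) • g.direction (g⁻¹.direction i)  ≡⟨ g.to-• (from 𝟎) (g⁻¹.direction i) ⟨
        to (from 𝟎 • g⁻¹.direction i)                ≡⟨ cong to (g⁻¹.to-• 𝟎 i) ⟨
        to (from (𝟎 • i))                            ≡⟨ strictlyInverseˡ (𝟎 • i) ⟩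
        𝟎 • i                                        ∎)

    directions : Permutation′ (suc n)
    directions = permutation g.direction g⁻¹.direction direction-direction⁻¹ direction⁻¹-direction

    -- Both maps send 𝟎 to the same vertex and turn a step in direction i into one in direction
    -- `g.direction i`; hence they agree along every path.
    act-Automorphism : ∀ v → act g.translation directions v ≡ to v
    act-Automorphism v = •-induction (λ v → act g.translation directions v ≡ to v)
      (λ v i e → trans (act-• g.translation directions v (suc i))
                       (trans (cong (_• g.direction (suc i)) e) (sym (g.to-• v (suc i)))))
      𝟎 v (trans (q-cong {w = g.translation} λ i → trans (cong (g.translation i xor_) (ℓ-𝟎 (directions ⟨$⟩ˡ i)))
                                     (Bool.xor-identityʳ _))
                 (q-ℓ (to 𝟎)))

  -- The isomorphism of Aut(FQ) with the semidirect product

  private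
    module A = Group (Aut (FQ n))
    module C = Group (C₂^ n ⋊S)

    perform : C.Carrier → V → V
    perform (u , σ) = act u σ

  q≡⇒≈ : ∀ u w → q u ≡ q w → Group._≈_ (𝔽₂^ suc n /⟨1⟩) u w
  q≡⇒≈ u w e = u zero xor w zero , λ i → begin
    u i                                   ≡⟨ move (u i) (u zero) ⟨
    (u i xor u zero) xor u zero           ≡⟨ cong (_xor u zero) (trans (sym (ℓ-q u i)) (trans (cong (λ v → ℓ v i) e) (ℓ-q w i))) ⟩
    (w i xor w zero) xor u zero           ≡⟨ solve 3 (λ a b c → (a :+ b) :+ c := a :+ (c :+ b)) refl (w i) (w zero) (u zero) ⟩
    w i xor (u zero xor w zero)           ∎
    where
    move : ∀ a b → (a xor b) xor b ≡ a
    move = solve 2 (λ a b → (a :+ b) :+ b := a) refl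

  ≈⇒q≡ : ∀ {u w} → Group._≈_ (𝔽₂^ suc n /⟨1⟩) u w → q u ≡ q w
  ≈⇒q≡ {u} {w} (c , e) = Vec.tabulate-cong λ i → trans (cong₂ _xor_ (e (suc i)) (e zero))
    (solve 3 (λ a b c → (a :+ c) :+ (b :+ c) := a :+ b) refl (w (suc i)) (w zero) c)

  -- The image of 𝟎 determines the class of u, and the images of its neighbours determine σ.
  perform-faithful : ∀ s t → (∀ v → perform s v ≡ perform t v) → s C.≈ t
  perform-faithful (u , σ) (w , τ) e =
      q≡⇒≈ u w (trans (sym (at-𝟎 u σ)) (trans (e 𝟎) (at-𝟎 w τ)))
    , λ i → •-injective (act u σ 𝟎) (begin
        act u σ 𝟎 • (σ ⟨$⟩ʳ i)   ≡⟨ act-• u σ 𝟎 i ⟨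
        act u σ (𝟎 • i)          ≡⟨ e (𝟎 • i) ⟩
        act w τ (𝟎 • i)          ≡⟨ act-• w τ 𝟎 i ⟩
        act w τ 𝟎 • (τ ⟨$⟩ʳ i)   ≡⟨ cong (_• (τ ⟨$⟩ʳ i)) (e 𝟎) ⟨
        act u σ 𝟎 • (τ ⟨$⟩ʳ i)   ∎)
    where
    at-𝟎 : ∀ u σ → act u σ 𝟎 ≡ q u
    at-𝟎 u σ = q-cong {w = u} λ i → trans (cong (u i xor_) (ℓ-𝟎 (σ ⟨$⟩ˡ i))) (Bool.xor-identityʳ _)

  perform-cong : ∀ s t → s C.≈ t → ∀ v → perform s v ≡ perform t v
  perform-cong (u , σ) (w , τ) ((c , e) , σ≈τ) v = ≈⇒q≡ {w = λ i → w i xor ℓ v (τ ⟨$⟩ˡ i)} (c , λ i → begin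
    u i xor ℓ v (σ ⟨$⟩ˡ i)          ≡⟨ cong₂ (λ a j → a xor ℓ v j) (e i) (Group.⁻¹-cong (symmetricGroup (suc n)) {σ} {τ} σ≈τ i) ⟩
    (w i xor c) xor ℓ v (τ ⟨$⟩ˡ i)  ≡⟨ solve 3 (λ a b c → (a :+ c) :+ b := (a :+ b) :+ c) refl (w i) (ℓ v (τ ⟨$⟩ˡ i)) c ⟩
    (w i xor ℓ v (τ ⟨$⟩ˡ i)) xor c  ∎)

  coordinates : A.Carrier → C.Carrier
  coordinates g = Automorphism.translation g , directions g

  private
    to : A.Carrier → V → V
    to g = Inverse.to (GraphIso.vertices g)

    -- Reduces each homomorphism law to an equality of maps on vertices.
    coordinates-unique : ∀ g s → (∀ v → to g v ≡ perform s v) → coordinates g C.≈ s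
    coordinates-unique g s e = perform-faithful (coordinates g) s λ v → trans (act-Automorphism g v) (e v)

    homo : ∀ g h → coordinates (g A.∙ h) C.≈ (coordinates g C.∙ coordinates h)
    homo g h = coordinates-unique (g A.∙ h) (coordinates g C.∙ coordinates h) λ v → begin
      to g (to h v)                                          ≡⟨ act-Automorphism g (to h v) ⟨
      perform (coordinates g) (to h v)                       ≡⟨ cong (perform (coordinates g)) (act-Automorphism h v) ⟨
      perform (coordinates g) (perform (coordinates h) v)    ≡⟨ act-∘ (Automorphism.translation g) (directions g) (Automorphism.translation h) (directions h) v ⟩
      perform (coordinates g C.∙ coordinates h) v            ∎

    ε-homo : coordinates A.ε C.≈ C.ε
    ε-homo = coordinates-unique A.ε C.ε λ v → sym (q-ℓ v)

    ⁻¹-homo : ∀ g → coordinates (g A.⁻¹) C.≈ (coordinates g C.⁻¹)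
    ⁻¹-homo g = GroupProperties.inverseˡ-unique (C₂^ n ⋊S) (coordinates (g A.⁻¹)) (coordinates g)
      (C.trans {coordinates (g A.⁻¹) C.∙ coordinates g} {coordinates (g A.⁻¹ A.∙ g)} {C.ε}
        (C.sym {coordinates (g A.⁻¹ A.∙ g)} {coordinates (g A.⁻¹) C.∙ coordinates g} (homo (g A.⁻¹) g))
        (coordinates-unique (g A.⁻¹ A.∙ g) C.ε λ v →
          trans (Inverse.strictlyInverseʳ (GraphIso.vertices g) v) (sym (q-ℓ v))))

  Aut-FQ : Aut (FQ n) ≅ᴳ (C₂^ n ⋊S)
  Aut-FQ = coordinates , record
    { isGroupMonomorphism = record
      { isGroupHomomorphism = record
        { isMonoidHomomorphism = record
          { isMagmaHomomorphism = record
            { isRelHomomorphism = record { cong = λ {g} {h} e → coordinates-unique g (coordinates h)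
                λ v → trans (e v) (sym (act-Automorphism h v)) }
            ; homo = homo
            }
          ; ε-homo = ε-homo
          }
        ; ⁻¹-homo = ⁻¹-homo
        }
      ; injective = λ {g} {h} e v → trans (sym (act-Automorphism g v))
          (trans (perform-cong (coordinates g) (coordinates h) e v) (act-Automorphism h v))
      }
    ; surjective = λ (u , σ) → automorphism u σ , λ {g} → coordinates-unique g (u , σ)
    }

-- Compact magic means constant sums over the 4-cycles of the torus

open ℕSolver.+-*-Solver using (solve; _:+_; _:*_; _:=_; con)

-- Distinct diagonals exclude closed walks that turn back. Mentioning only adjacency and inequality
-- makes the notion invariant under every graph isomorphism.
record FourCycle (G : Graph) (p q r s : Graph.Vertex G) : Set where
  constructor fourCycle
  open Graph G
  field
    pq  : Adj p q
    qr  : Adj q r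
    rs  : Adj r s
    sp  : Adj s p
    p≢r : p ≢ r
    q≢s : q ≢ s

FourCycle-map : ∀ {G H} (φ : GraphIso G H) {p q r s} → let f = Inverse.to (GraphIso.vertices φ) in
                FourCycle G p q r s → FourCycle H (f p) (f q) (f r) (f s)
FourCycle-map φ (fourCycle pq qr rs sp p≢r q≢s) =
  fourCycle (edge pq) (edge qr) (edge rs) (edge sp) (p≢r ∘ injective) (q≢s ∘ injective)
  where
  open Inverse (GraphIso.vertices φ)
  edge : ∀ {x y} → _ → _
  edge {x} {y} = Equivalence.to (GraphIso.adjacent φ x y)
  injective : ∀ {x y} → to x ≡ to y → x ≡ y
  injective {x} {y} e = trans (sym (strictlyInverseʳ x)) (trans (cong from e) (strictlyInverseʳ y))

-- Such a cycle runs once around C₄ in one of the two senses; all 256 quadruples are checked by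
-- decision.
C₄-fourCycle : ∀ a b c d →
  Graph.Adj C₄ a b × Graph.Adj C₄ b c × Graph.Adj C₄ c d × Graph.Adj C₄ d a × a ≢ c × b ≢ d →
  (b ≡ a +1 × c ≡ a +1 +1 × d ≡ a +1 +1 +1) ⊎ (d ≡ a +1 × c ≡ a +1 +1 × b ≡ a +1 +1 +1)
C₄-fourCycle = from-yes (Fin.all? λ a → Fin.all? λ b → Fin.all? λ c → Fin.all? λ d →
  (adj? a b ×-dec adj? b c ×-dec adj? c d ×-dec adj? d a ×-dec ¬? (a Fin.≟ c) ×-dec ¬? (b Fin.≟ d))
  →-dec
  (((b Fin.≟ a +1) ×-dec (c Fin.≟ a +1 +1) ×-dec (d Fin.≟ a +1 +1 +1)) ⊎-dec
   ((d Fin.≟ a +1) ×-dec (c Fin.≟ a +1 +1) ×-dec (b Fin.≟ a +1 +1 +1))))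
  where
  adj? = λ (a b : Fin 4) → (b Fin.≟ a +1) ⊎-dec (a Fin.≟ b +1)

rotate : ∀ a b c d → b ℕ.+ c ℕ.+ d ℕ.+ a ≡ a ℕ.+ b ℕ.+ c ℕ.+ d
rotate = solve 4 (λ a b c d → b :+ c :+ d :+ a := a :+ b :+ c :+ d) refl

C₄-sum : ∀ (f : Fin 4 → ℕ) a → f a ℕ.+ f (a +1) ℕ.+ f (a +1 +1) ℕ.+ f (a +1 +1 +1) ≡ f 0F ℕ.+ f 1F ℕ.+ f 2F ℕ.+ f 3F
C₄-sum f 0F = refl
C₄-sum f 1F = rotate (f 0F) _ _ _
C₄-sum f 2F = trans (rotate (f 1F) _ _ _) (rotate (f 0F) _ _ _)
C₄-sum f 3F = sym (rotate (f 3F) _ _ _)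

C₄-fourCycle-sum : ∀ (f : Fin 4 → ℕ) {a b c d} → FourCycle C₄ a b c d →
                   f a ℕ.+ f b ℕ.+ f c ℕ.+ f d ≡ f 0F ℕ.+ f 1F ℕ.+ f 2F ℕ.+ f 3F
C₄-fourCycle-sum f {a} {b} {c} {d} (fourCycle pq qr rs sp p≢r q≢s) =
  sum (C₄-fourCycle a b c d (pq , qr , rs , sp , p≢r , q≢s))
  where
  sum : (b ≡ a +1 × c ≡ a +1 +1 × d ≡ a +1 +1 +1) ⊎ (d ≡ a +1 × c ≡ a +1 +1 × b ≡ a +1 +1 +1) →
        f a ℕ.+ f b ℕ.+ f c ℕ.+ f d ≡ f 0F ℕ.+ f 1F ℕ.+ f 2F ℕ.+ f 3F
  sum (inj₁ (refl , refl , refl)) = C₄-sum f a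
  sum (inj₂ (refl , refl , refl)) = trans
    (solve 4 (λ a b c d → a :+ b :+ c :+ d := a :+ d :+ c :+ b) refl (f a) (f b) (f c) (f d))
    (C₄-sum f a)

module _ {m : ℕ} where

  agree-off : Position m → Position m → Fin m → Set
  agree-off p q i = ∀ j → j ≢ i → lookup p j ≡ lookup q j

  ≡-update : ∀ (p q : Position m) i → agree-off p q i → q ≡ p [ i ]≔ lookup q i
  ≡-update p q i e = lookup-injective lemma
    where
    lemma : ∀ j → lookup q j ≡ lookup (p [ i ]≔ lookup q i) j
    lemma j with j Fin.≟ i
    ... | yes refl = sym (Vec.lookup∘update i p _)
    ... | no j≢i = trans (sym (e j j≢i)) (sym (Vec.lookup∘update′ j≢i p _))

  ≡-update₂ : ∀ (p q : Position m) i l → i ≢ l → (∀ j → j ≢ i → j ≢ l → lookup p j ≡ lookup q j) →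
              q ≡ p [ i ]≔ lookup q i [ l ]≔ lookup q l
  ≡-update₂ p q i l i≢l e = ≡-update (p [ i ]≔ lookup q i) q l lemma
    where
    lemma : ∀ j → j ≢ l → lookup (p [ i ]≔ lookup q i) j ≡ lookup q j
    lemma j j≢l with j Fin.≟ i
    ... | yes refl = Vec.lookup∘update i p _
    ... | no j≢i = trans (Vec.lookup∘update′ j≢i p _) (e j j≢i j≢l)

  -- The corners of `square` are all written as double updates of p, even where an update changes
  -- nothing, so that they match the summands of `squareSum`.
  data LineOrSquare (p q r s : Position m) : Set where
    line   : ∀ i → agree-off p q i → agree-off p r i → agree-off p s i →
             FourCycle C₄ (lookup p i) (lookup q i) (lookup r i) (lookup s i) → LineOrSquare p q r s
    square : ∀ i l → i ≢ l → ∀ {a b} → Graph.Adj C₄ (lookup p i) a → Graph.Adj C₄ (lookup p l) b →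
             q ≡ p [ i ]≔ a [ l ]≔ lookup p l → r ≡ p [ i ]≔ a [ l ]≔ b →
             s ≡ p [ i ]≔ lookup p i [ l ]≔ b → LineOrSquare p q r s

  C₄-irreflexive : ∀ {a b} → Graph.Adj C₄ a b → a ≢ b
  C₄-irreflexive {a} e refl = irr a e
    where
    irr : ∀ a → Graph.Adj C₄ a a → ⊥
    irr = from-yes (Fin.all? λ a → ¬? ((a Fin.≟ a +1) ⊎-dec (a Fin.≟ a +1)))

  -- A closed walk cannot change a coordinate exactly once. So the coordinates of the four steps
  -- follow one of the patterns iiii, ijji, iijj, ijij. The second would give q ≡ s and the third p
  -- ≡ r; the first is a line and the last a square.
  lineOrSquare : ∀ {p q r s} → FourCycle (C₄ □^ m) p q r s → LineOrSquare p q r s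
  lineOrSquare {p} {q} {r} {s}
    (fourCycle (i , pq , p≈q) (j , qr , q≈r) (k , rs , r≈s) (l , sp , s≈p) p≢r q≢s)
    with i Fin.≟ l
  ... | yes refl with j Fin.≟ i | k Fin.≟ i
  ...   | yes refl | yes refl = line i p≈q (λ x x≢i → trans (p≈q x x≢i) (q≈r x x≢i))
            (λ x x≢i → sym (s≈p x x≢i))
            (fourCycle pq qr rs sp
              (λ e → p≢r (lookup-injective (everywhere {p} {r} (λ x x≢i → trans (p≈q x x≢i) (q≈r x x≢i)) e)))
              (λ e → q≢s (lookup-injective (everywhere {q} {s} (λ x x≢i → trans (q≈r x x≢i) (r≈s x x≢i)) e))))
    where
    everywhere : ∀ {x y : Position m} → agree-off x y i → lookup x i ≡ lookup y i → ∀ j → lookup x j ≡ lookup y j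
    everywhere e eᵢ j with j Fin.≟ i
    ... | yes refl = eᵢ
    ... | no j≢i = e j j≢i
  ...   | yes refl | no k≢i = ⊥-elim (C₄-irreflexive rs
            (trans (sym (q≈r k k≢i)) (trans (sym (p≈q k k≢i)) (sym (s≈p k k≢i)))))
  ...   | no j≢i | _ with k Fin.≟ j
  ...     | no k≢j = ⊥-elim (C₄-irreflexive qr (trans (sym (p≈q j j≢i))
              (trans (sym (s≈p j j≢i)) (sym (r≈s j (k≢j ∘ sym))))))
  ...     | yes refl = ⊥-elim (q≢s (lookup-injective same))
    where
    same : ∀ x → lookup q x ≡ lookup s x
    same x with x Fin.≟ i
    ... | yes refl = trans (q≈r i (j≢i ∘ sym)) (r≈s i (j≢i ∘ sym))
    ... | no x≢i = trans (sym (p≈q x x≢i)) (sym (s≈p x x≢i))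
  lineOrSquare {p} {q} {r} {s}
    (fourCycle (i , pq , p≈q) (j , qr , q≈r) (k , rs , r≈s) (l , sp , s≈p) p≢r q≢s)
      | no i≢l with j Fin.≟ i
  ...   | yes refl = ⊥-elim (p≢r (lookup-injective same))
    where
    k≡l : k ≡ l
    k≡l with k Fin.≟ l
    ... | yes e = e
    ... | no k≢l = ⊥-elim (C₄-irreflexive sp (trans (sym (r≈s l (k≢l ∘ sym)))
            (trans (sym (q≈r l (i≢l ∘ sym))) (sym (p≈q l (i≢l ∘ sym))))))
    same : ∀ x → lookup p x ≡ lookup r x
    same x with x Fin.≟ i
    ... | yes refl = trans (sym (s≈p i i≢l)) (sym (r≈s i (λ e → i≢l (trans e k≡l))))
    ... | no x≢i = trans (p≈q x x≢i) (q≈r x x≢i)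
  ...   | no j≢i with j Fin.≟ l
  ...     | no j≢l = ⊥-elim (i≢l (trans (sym k≡i) k≡l))
    where
    k≡l : k ≡ l
    k≡l with k Fin.≟ l
    ... | yes e = e
    ... | no k≢l = ⊥-elim (C₄-irreflexive sp (trans (sym (r≈s l (k≢l ∘ sym)))
            (trans (sym (q≈r l (j≢l ∘ sym))) (sym (p≈q l (i≢l ∘ sym))))))
    k≡i : k ≡ i
    k≡i with k Fin.≟ i
    ... | yes e = e
    ... | no k≢i = ⊥-elim (C₄-irreflexive pq (trans (sym (s≈p i i≢l))
            (trans (sym (r≈s i (k≢i ∘ sym))) (sym (q≈r i (j≢i ∘ sym))))))
  ...     | yes refl = square i l i≢l pq (Graph.Adj-sym C₄ sp)
              (trans (≡-update₂ p q i l i≢l (λ x x≢i x≢l → p≈q x x≢i))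
                     (cong (λ a → p [ i ]≔ lookup q i [ l ]≔ a) (sym (p≈q l (i≢l ∘ sym)))))
              (trans (≡-update₂ p r i l i≢l (λ x x≢i x≢l → trans (p≈q x x≢i) (q≈r x x≢l)))
                     (cong₂ (λ a b → p [ i ]≔ a [ l ]≔ b) (sym (q≈r i i≢l)) (r≈s l (λ e → i≢l (trans (sym k≡i) (sym e))))))
              (trans (≡-update₂ p s i l i≢l (λ x x≢i x≢l → sym (s≈p x x≢l)))
                     (cong (λ a → p [ i ]≔ a [ l ]≔ lookup s l) (s≈p i i≢l)))
    where
    k≡i : k ≡ i
    k≡i with k Fin.≟ i
    ... | yes e = e
    ... | no k≢i = ⊥-elim (C₄-irreflexive pq (trans (sym (s≈p i i≢l))
            (trans (sym (r≈s i (k≢i ∘ sym))) (sym (q≈r i (j≢i ∘ sym))))))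

  Balanced : ℕ → (Position m → ℕ) → Set
  Balanced c F = ∀ {p q r s} → FourCycle (C₄ □^ m) p q r s → F p ℕ.+ F q ℕ.+ F r ℕ.+ F s ≡ c

  compactMagic⇒balanced : (A : Arrangement m) (M : IsCompactMagic A) → Balanced (proj₁ M) (entry A)
  compactMagic⇒balanced A (c , lines , squares) {p} {q} {r} {s} cycle with lineOrSquare cycle
  ... | line i p≈q p≈r p≈s cycle′ = trans
    (cong₂ ℕ._+_ (cong₂ ℕ._+_ (cong₂ ℕ._+_ (at (λ _ _ → refl)) (at p≈q)) (at p≈r)) (at p≈s))
    (trans (C₄-fourCycle-sum (λ a → entry A (p [ i ]≔ a)) cycle′) (lines p i))
    where
    at : ∀ {x} → agree-off p x i → entry A x ≡ entry A (p [ i ]≔ lookup x i)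
    at {x} e = cong (entry A) (≡-update p x i e)
  ... | square i l i≢l {a} {b} pᵢa pₗb refl refl refl = trans
    (cong (λ x → x ℕ.+ f a (lookup p l) ℕ.+ f a b ℕ.+ f (lookup p i) b)
          (cong (entry A) (≡-update₂ p p i l i≢l (λ _ _ _ → refl))))
    (sum pᵢa pₗb)
    where
    f : Fin 4 → Fin 4 → ℕ
    f a b = entry A (p [ i ]≔ a [ l ]≔ b)
    -- A neighbour in C₄ may lie on either side, so each case selects the corner from which
    -- `squares` counts upwards.
    sum : ∀ {a b a′ b′} → Graph.Adj C₄ a a′ → Graph.Adj C₄ b b′ → f a b ℕ.+ f a′ b ℕ.+ f a′ b′ ℕ.+ f a b′ ≡ c
    sum {a} {b} (inj₁ refl) (inj₁ refl) = trans
      (solve 4 (λ w x y z → w :+ x :+ y :+ z := w :+ z :+ x :+ y) refl (f a b) (f (a +1) b) (f (a +1) (b +1)) (f a (b +1)))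
      (squares p i l i≢l a b)
    sum {a} {b} {a′} {b′} (inj₁ refl) (inj₂ refl) = trans
      (solve 4 (λ w x y z → w :+ x :+ y :+ z := z :+ w :+ y :+ x) refl (f a b) (f (a +1) b) (f (a +1) b′) (f a b′))
      (squares p i l i≢l a b′)
    sum {a} {b} {a′} {b′} (inj₂ refl) (inj₁ refl) = trans
      (solve 4 (λ w x y z → w :+ x :+ y :+ z := x :+ y :+ w :+ z) refl (f a b) (f a′ b) (f a′ (b +1)) (f a (b +1)))
      (squares p i l i≢l a′ b)
    sum {a} {b} {a′} {b′} (inj₂ refl) (inj₂ refl) = trans
      (solve 4 (λ w x y z → w :+ x :+ y :+ z := y :+ x :+ z :+ w) refl (f a b) (f a′ b) (f a′ b′) (f a b′))
      (squares p i l i≢l a′ b′)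

  update-adj : ∀ (p : Position m) i {a b} → Graph.Adj C₄ a b → Graph.Adj (C₄ □^ m) (p [ i ]≔ a) (p [ i ]≔ b)
  update-adj p i {a} {b} e = i
    , subst₂ (Graph.Adj C₄) (sym (Vec.lookup∘update i p a)) (sym (Vec.lookup∘update i p b)) e
    , λ j j≢i → trans (Vec.lookup∘update′ j≢i p a) (sym (Vec.lookup∘update′ j≢i p b))

  update-injective : ∀ (p p′ : Position m) i {a b} → p [ i ]≔ a ≡ p′ [ i ]≔ b → a ≡ b
  update-injective p p′ i {a} {b} e =
    trans (sym (Vec.lookup∘update i p a)) (trans (cong (λ x → lookup x i) e) (Vec.lookup∘update i p′ b))

  balanced⇒compactMagic : (A : Arrangement m) → ∀ {c} → Balanced c (entry A) → IsCompactMagic A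
  balanced⇒compactMagic A {c} balanced = c
    , (λ p i → balanced (fourCycle
        (update-adj p i (inj₁ refl)) (update-adj p i (inj₁ refl)) (update-adj p i (inj₁ refl)) (update-adj p i (inj₁ refl))
        (0≢2 ∘ update-injective p p i) (1≢3 ∘ update-injective p p i)))
    , λ p i l i≢l a b → trans
        (solve 4 (λ w x y z → w :+ x :+ y :+ z := w :+ x :+ z :+ y) refl
          (entry A (p [ i ]≔ a [ l ]≔ b)) (entry A (p [ i ]≔ a [ l ]≔ (b +1)))
          (entry A (p [ i ]≔ (a +1) [ l ]≔ b)) (entry A (p [ i ]≔ (a +1) [ l ]≔ (b +1))))
        (balanced (fourCycle
          (update-adj (p [ i ]≔ a) l (inj₁ refl))
          (swap-adj p i≢l (inj₁ refl))
          (update-adj (p [ i ]≔ (a +1)) l (inj₂ refl))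
          (swap-adj p i≢l (inj₂ refl))
          (C₄-irreflexive (inj₁ refl) ∘ update-injective (p [ i ]≔ a) (p [ i ]≔ (a +1)) l)
          (C₄-irreflexive (inj₂ refl) ∘ update-injective (p [ i ]≔ a) (p [ i ]≔ (a +1)) l)))
    where
    0≢2 : 0F ≢ 2F
    0≢2 ()
    1≢3 : 1F ≢ 3F
    1≢3 ()
    swap-adj : ∀ (p : Position m) {i l} → i ≢ l → ∀ {a b c} → Graph.Adj C₄ a b →
               Graph.Adj (C₄ □^ m) (p [ i ]≔ a [ l ]≔ c) (p [ i ]≔ b [ l ]≔ c)
    swap-adj p {i} {l} i≢l {a} {b} {c} e = subst₂ (Graph.Adj (C₄ □^ m))
      (Vec.[]≔-commutes p l i (i≢l ∘ sym)) (Vec.[]≔-commutes p l i (i≢l ∘ sym))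
      (update-adj (p [ l ]≔ c) i e)

-- From the torus to the folded cube

module Magic (m : ℕ) where
  open FoldedCube m

  Magic : ℕ → (V → ℕ) → Set
  Magic c F = ∀ v {i j} → i ≢ j → F v ℕ.+ F (v • i) ℕ.+ F (v • i • j) ℕ.+ F (v • j) ≡ c

  magic-cong : ∀ {c F G} → (∀ v → F v ≡ G v) → Magic c F → Magic c G
  magic-cong e magic v {i} {j} i≢j = trans
    (sym (cong₂ ℕ._+_ (cong₂ ℕ._+_ (cong₂ ℕ._+_ (e v) (e (v • i))) (e (v • i • j))) (e (v • j))))
    (magic v i≢j)

  Q-fourCycle : ∀ v {i j} → i ≢ j → FourCycle (Q n) v (v • suc i) (v • suc i • suc j) (v • suc j)
  Q-fourCycle v {i} {j} i≢j = fourCycle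
    (•⇒Q-adj v i)
    (•⇒Q-adj (v • suc i) j)
    (Graph.Adj-sym (Q n) {v • suc j} {v • suc i • suc j}
      (subst (Graph.Adj (Q n) (v • suc j)) (•-comm v (suc j) (suc i)) (•⇒Q-adj (v • suc j) i)))
    (Graph.Adj-sym (Q n) {v} {v • suc j} (•⇒Q-adj v j))
    (λ e → i≢j (Fin.suc-injective (•-cancel v (sym e))))
    (λ e → i≢j (Fin.suc-injective (•-injective v e)))

  -- By `•-pairs`, the two ways from v to the opposite corner x use the same two directions; as w ≢
  -- z, they use them in opposite orders.
  Q-fourCycle⇒• : ∀ {v w x z} → FourCycle (Q n) v w x z →
                  ∃[ i ] ∃[ j ] i ≢ j × w ≡ v • suc i × x ≡ v • suc i • suc j × z ≡ v • suc j
  Q-fourCycle⇒• {v} {w} {x} {z} (fourCycle vw wx xz zv v≢x w≢z)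
    with i , refl ← Q-adj⇒• {v} {w} vw
    with k , refl ← Q-adj⇒• {w} {x} wx
    with l , ez ← Q-adj⇒• {x} {z} xz
    with j , ev ← Q-adj⇒• {z} {v} zv
    with z≡ ← (trans (sym (•-involutive z (suc j))) (cong (_• suc j) (sym ev)))
    with •-pairs v {suc i} {suc k} {suc j} {suc l}
           (λ { refl → v≢x (sym (•-involutive v (suc i))) })
           (trans (sym (•-involutive (v • suc i • suc k) (suc l))) (cong (_• suc l) (trans (sym ez) z≡)))
  ... | inj₁ (refl , _) = ⊥-elim (w≢z (sym z≡))
  ... | inj₂ (refl , refl) = i , k , (λ { refl → v≢x (sym (•-involutive v (suc i))) }) , refl , refl , z≡

  -- Flipping every coordinate but the i-th is an odd number of flips, each of
  -- which replaces the edge sum S by c - S; so the faces through antipodal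
  -- edges have sum c as well.
  module _ {c : ℕ} {F : V → ℕ}
           (faces : ∀ v {i j} → i ≢ j →
                    F v ℕ.+ F (v • suc i) ℕ.+ F (v • suc i • suc j) ℕ.+ F (v • suc j) ≡ c) where

    private
      module _ (i : Fin n) where
        S : V → ℕ
        S v = F v ℕ.+ F (v • suc i)

        S-flip : ∀ v {j} → i ≢ j → S v ℕ.+ S (v • suc j) ≡ c
        S-flip v {j} i≢j = trans
          (trans (cong (λ x → S v ℕ.+ (F (v • suc j) ℕ.+ F x)) (•-comm v (suc j) (suc i)))
                 (solve 4 (λ a b c d → (a :+ b) :+ (c :+ d) := a :+ b :+ d :+ c) refl
                    (F v) (F (v • suc i)) (F (v • suc j)) (F (v • suc i • suc j))))
          (faces v i≢j)

        S-fixed : ∀ v → S (v • suc i) ≡ S v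
        S-fixed v = trans (cong (λ x → F (v • suc i) ℕ.+ F x) (•-involutive v (suc i)))
                          (ℕ.+-comm (F (v • suc i)) (F v))

        -- The two possible values S and c - S, with the second stated additively to stay in ℕ. The
        -- Boolean is the parity of the steps in directions other than i, and these are the steps
        -- that toggle coordinate `suc i` of y.
        Related : V → Bool → V → Set
        Related v false w = S w ≡ S v
        Related v true  w = S v ℕ.+ S w ≡ c

        related : ∀ v w → Related v (y v (suc i) xor y w (suc i)) w
        related v w = •-induction (λ w → Related v (y v (suc i) xor y w (suc i)) w) step v w
          (subst (λ b → Related v b v) (sym (Bool.xor-same (y v (suc i)))) refl)
          where
          flipped : ∀ b {j} w → i ≢ j → Related v b w → Related v (not b) (w • suc j)
          flipped false {j} w i≢j e = trans (cong (ℕ._+ S (w • suc j)) (sym e)) (S-flip w i≢j)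
          flipped true {j} w i≢j e = ℕ.+-cancelʳ-≡ (S w) (S (w • suc j)) (S v)
            (trans (ℕ.+-comm (S (w • suc j)) (S w)) (trans (S-flip w i≢j) (sym e)))
          fixed : ∀ b w → Related v b w → Related v b (w • suc i)
          fixed false w e = trans (S-fixed w) e
          fixed true  w e = trans (cong (S v ℕ.+_) (S-fixed w)) e
          step : ∀ w j → Related v (y v (suc i) xor y w (suc i)) w →
                 Related v (y v (suc i) xor y (w • suc j) (suc i)) (w • suc j)
          step w j r with i Fin.≟ j
          ... | yes refl = subst (λ b → Related v b (w • suc i))
            (cong (y v (suc i) xor_) (sym (trans (y-• w (suc i) (suc i))
              (trans (cong (λ d → y w (suc i) xor not d) (δ-refl i)) (Bool.xor-identityʳ _)))))
            (fixed _ w r)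
          ... | no i≢j = subst (λ b → Related v b (w • suc j))
            (trans (Bool.not-distribʳ-xor (y v (suc i)) (y w (suc i)))
              (cong (y v (suc i) xor_) (sym (trans (y-• w (suc j) (suc i))
                (trans (cong (λ d → y w (suc i) xor not d) (δ-≢ (i≢j ∘ sym))) (Bool.xor-comm _ true))))))
            (flipped _ w i≢j r)

        S-antipode : ∀ v → S v ℕ.+ S (v • zero) ≡ c
        S-antipode v = subst (λ b → Related v b (v • zero))
          (trans (cong (y v (suc i) xor_) (y-• v zero (suc i)))
            (trans (sym (Bool.xor-assoc (y v (suc i)) _ _)) (cong (_xor true) (Bool.xor-same (y v (suc i))))))
          (related v (v • zero))

    faces⇒magic : Magic c F
    faces⇒magic v {zero}  {zero}  0≢0 = ⊥-elim (0≢0 refl)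
    faces⇒magic v {suc i} {suc j} i≢j = faces v (i≢j ∘ cong suc)
    faces⇒magic v {zero}  {suc i} _ = trans
      (solve 4 (λ a b c d → a :+ b :+ c :+ d := (a :+ d) :+ (b :+ c)) refl
        (F v) (F (v • zero)) (F (v • zero • suc i)) (F (v • suc i)))
      (S-antipode i v)
    faces⇒magic v {suc i} {zero}  _ = trans
      (trans (cong (λ x → F v ℕ.+ F (v • suc i) ℕ.+ F x ℕ.+ F (v • zero)) (•-comm v (suc i) zero))
        (solve 4 (λ a b c d → a :+ b :+ c :+ d := (a :+ b) :+ (d :+ c)) refl
          (F v) (F (v • suc i)) (F (v • zero • suc i)) (F (v • zero))))
      (S-antipode i v)

  -- A face with directions i and j goes to a face with directions `direction i` and `direction j`,
  -- which are again different.
  magic-∘ : ∀ {c F} (g : GraphIso (FQ n) (FQ n)) → Magic c F → Magic c (F ∘ Inverse.to (GraphIso.vertices g))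
  magic-∘ {c} {F} g magic v {i} {j} i≢j = trans
    (cong₂ ℕ._+_ (cong₂ ℕ._+_ (cong (F (to v) ℕ.+_) (cong F (to-• v i)))
      (cong F (trans (to-• (v • i) j) (cong (_• direction j) (to-• v i))))) (cong F (to-• v j)))
    (magic (to v) (i≢j ∘ direction-injective))
    where
    open Inverse (GraphIso.vertices g)
    open Automorphism g

  module _ (φ : GraphIso (C₄ □^ m) (Q n)) where
    open Inverse (GraphIso.vertices φ)

    onVertices : Arrangement m → V → ℕ
    onVertices A = entry A ∘ from

    compactMagic⇒magic : ∀ A → IsCompactMagic A → ∃[ c ] Magic c (onVertices A)
    compactMagic⇒magic A M = proj₁ M , faces⇒magic {F = onVertices A} λ v i≢j →
      compactMagic⇒balanced A M (FourCycle-map (symᵍ φ) (Q-fourCycle v i≢j))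

    magic⇒compactMagic : ∀ A {c} → Magic c (onVertices A) → IsCompactMagic A
    magic⇒compactMagic A {c} magic = balanced⇒compactMagic A balanced
      where
      balanced : Balanced c (entry A)
      balanced {p} {q} {r} {s} cycle
        with Q-fourCycle⇒• (FourCycle-map φ cycle)
      ... | i , j , i≢j , eq , er , es = trans
        (cong₂ ℕ._+_ (cong₂ ℕ._+_ (cong₂ ℕ._+_
            (cong (entry A) (sym (strictlyInverseʳ p))) (at eq)) (at er)) (at es))
        (magic (to p) (i≢j ∘ Fin.suc-injective))
        where
        at : ∀ {x v} → to x ≡ v → entry A x ≡ onVertices A v
        at {x} refl = cong (entry A) (sym (strictlyInverseʳ x))

    stable : Stable (naturalAction φ) IsCompactMagic
    stable g A M with c , magic ← compactMagic⇒magic A M =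
      magic⇒compactMagic (LeftAction._▷_ (naturalAction φ) g A)
        (magic-cong {F = onVertices A ∘ Inverse.from (GraphIso.vertices g)}
          (λ v → cong (onVertices A ∘ Inverse.from (GraphIso.vertices g)) (sym (strictlyInverseˡ v)))
          (magic-∘ {F = onVertices A} (symᵍ g) magic))

-- Binary expansions as subset sums

module Σℕ = Sum ℕ.+-0-commutativeMonoid

bit : Bool → ℕ
bit false = 0
bit true  = 1

subsetSum : ∀ {k} → (Fin k → ℕ) → (Fin k → Bool) → ℕ
subsetSum b w = Σℕ.sum λ i → bit (w i) * b i

subsetSum-cong : ∀ {k} {b c : Fin k → ℕ} {v w : Fin k → Bool} →
                 (∀ i → b i ≡ c i) → (∀ i → v i ≡ w i) → subsetSum b v ≡ subsetSum c w
subsetSum-cong e f = Σℕ.sum-cong-≗ λ i → cong₂ (λ a x → bit a * x) (f i) (e i)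

subsetSum-*ˡ : ∀ {k} x (b : Fin k → ℕ) w → subsetSum (λ i → x * b i) w ≡ x * subsetSum b w
subsetSum-*ˡ {zero}  x b w = sym (ℕ.*-zeroʳ x)
subsetSum-*ˡ {suc k} x b w = begin
  bit (w zero) * (x * b zero) ℕ.+ subsetSum (λ i → x * b (suc i)) (w ∘ suc)
    ≡⟨ cong₂ ℕ._+_ (solve 3 (λ a x b → a :* (x :* b) := x :* (a :* b)) refl (bit (w zero)) x (b zero))
                 (subsetSum-*ˡ x (b ∘ suc) (w ∘ suc)) ⟩
  x * (bit (w zero) * b zero) ℕ.+ x * subsetSum (b ∘ suc) (w ∘ suc)
    ≡⟨ ℕ.*-distribˡ-+ x _ _ ⟨
  x * subsetSum b w ∎

powersOf2 : ∀ {k} → Fin k → ℕ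
powersOf2 i = 2 ^ toℕ i

-- The head is the least significant digit: `combine` places its second argument lowest, hence the
-- swap in `uncons`.
binary : ∀ k → Vec Bool k ↔ Fin (2 ^ k)
binary zero    = mk↔ₛ′ (λ _ → zero) (λ _ → []) (λ { zero → refl }) (λ { [] → refl })
binary (suc k) =
  cast-id (ℕ.*-comm (2 ^ k) 2) ↔-∘ (↔-sym Fin.*↔× ↔-∘ ((binary k ×-↔ ↔-sym Fin.2↔Bool) ↔-∘ uncons))
  where
  uncons : Vec Bool (suc k) ↔ (Vec Bool k × Bool)
  uncons = mk↔ₛ′ (λ { (b ∷ v) → v , b }) (λ (v , b) → b ∷ v) (λ _ → refl) (λ { (b ∷ v) → refl })

toℕ-binary : ∀ {k} v → toℕ (Inverse.to (binary k) v) ≡ subsetSum powersOf2 (lookup v)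
toℕ-binary []              = refl
toℕ-binary {suc k} (b ∷ v) = begin
  toℕ (cast (ℕ.*-comm (2 ^ k) 2) (combine {2 ^ k} (Inverse.to (binary k) v) (digit b)))
    ≡⟨ Fin.toℕ-cast (ℕ.*-comm (2 ^ k) 2) _ ⟩
  toℕ (combine {2 ^ k} (Inverse.to (binary k) v) (digit b))
    ≡⟨ Fin.toℕ-combine (Inverse.to (binary k) v) (digit b) ⟩
  2 * toℕ (Inverse.to (binary k) v) ℕ.+ toℕ (digit b)
    ≡⟨ cong₂ (λ x y → 2 * x ℕ.+ y) (toℕ-binary v) (toℕ-digit b) ⟩
  2 * subsetSum powersOf2 (lookup v) ℕ.+ bit b
    ≡⟨ solve 2 (λ x y → con 2 :* x :+ y := y :* con 1 :+ con 2 :* x) refl (subsetSum powersOf2 (lookup v)) (bit b) ⟩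
  bit b * 1 ℕ.+ 2 * subsetSum powersOf2 (lookup v)
    ≡⟨ cong (bit b * 1 ℕ.+_) (subsetSum-*ˡ 2 powersOf2 (lookup v)) ⟨
  subsetSum powersOf2 (lookup (b ∷ v)) ∎
  where
  digit : Bool → Fin 2
  digit = Inverse.from Fin.2↔Bool
  toℕ-digit : ∀ b → toℕ (digit b) ≡ bit b
  toℕ-digit false = refl
  toℕ-digit true  = refl

-- The standard arrangement

module Existence (m : ℕ) where
  open FoldedCube m
  open Magic m

  module _ (i : Fin (suc n)) where

    -- Inserting the parity of w makes the total weight even, so the n coordinates of y other than i
    -- can be prescribed freely.
    fill : (Fin n → Bool) → V
    fill w = q (insertAt w i (par w))

    abstract
      par-remove : ∀ u → par u ≡ u i xor par (removeAt u i)
      par-remove u = Σ₂.sum-remove u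

      y-fill : ∀ w j → y (fill w) (punchIn i j) ≡ w j
      y-fill w j = begin
        y (fill w) (punchIn i j)                   ≡⟨ y-q (insertAt w i (par w)) (punchIn i j) ⟩
        insertAt w i (par w) (punchIn i j) xor par (insertAt w i (par w))
          ≡⟨ cong₂ _xor_ (insertAt-punchIn w i (par w) j) (begin
               par (insertAt w i (par w))
                 ≡⟨ par-remove (insertAt w i (par w)) ⟩
               insertAt w i (par w) i xor par (removeAt (insertAt w i (par w)) i)
                 ≡⟨ cong₂ _xor_ (insertAt-lookup w i (par w)) (Σ₂.sum-cong-≗ (removeAt-insertAt w i (par w))) ⟩
               par w xor par w
                 ≡⟨ Bool.xor-same (par w) ⟩
               false ∎) ⟩
        w j xor false                              ≡⟨ Bool.xor-identityʳ (w j) ⟩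
        w j                                        ∎

      -- The omitted coordinate is the parity of the others, because `y v` has even weight.
      y-injective-off : ∀ v w → (∀ j → y v (punchIn i j) ≡ y w (punchIn i j)) → v ≡ w
      y-injective-off v w e = y-injective lemma
        where
        at : ∀ v → y v i ≡ par (removeAt (y v) i)
        at v = xor-cancelˡ (y v i) (trans (Bool.xor-same (y v i)) (trans (sym (par-y v)) (par-remove (y v))))
        lemma : ∀ j → y v j ≡ y w j
        lemma j with i Fin.≟ j
        ... | yes refl = trans (at v) (trans (Σ₂.sum-cong-≗ e) (sym (at w)))
        ... | no i≢j = subst (λ j → y v j ≡ y w j) (Fin.punchIn-punchOut i≢j) (e (punchOut i≢j))

  evenCoordinates : V ↔ V
  evenCoordinates = mk↔ₛ′
    (λ v → tabulate (y v ∘ suc))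
    (λ w → fill zero (lookup w))
    (λ w → trans (Vec.tabulate-cong (y-fill zero (lookup w))) (Vec.tabulate∘lookup w))
    (λ v → y-injective-off zero (fill zero (lookup (tabulate (y v ∘ suc)))) v λ j →
      trans (y-fill zero (lookup (tabulate (y v ∘ suc))) j) (Vec.lookup∘tabulate (y v ∘ suc) j))

  2^n≡4^m : 2 ^ n ≡ 4 ^ m
  2^n≡4^m = trans (cong (2 ^_) (ℕ.*-comm m 2)) (sym (ℕ.^-*-assoc 2 2 m))

  standard : V ↔ Fin (4 ^ m)
  standard = cast-id 2^n≡4^m ↔-∘ (binary n ↔-∘ evenCoordinates)

  abstract
    toℕ-standard : ∀ v → toℕ (Inverse.to standard v) ≡ subsetSum powersOf2 (y v ∘ suc)
    toℕ-standard v = trans (Fin.toℕ-cast 2^n≡4^m _) (trans (toℕ-binary (tabulate (y v ∘ suc)))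
      (subsetSum-cong {b = powersOf2} (λ _ → refl) (Vec.lookup∘tabulate (y v ∘ suc))))

    -- Around the face the steps have directions i, j, i, j. Coordinate x is toggled by all of them,
    -- or by every other one if x is i or j; either way it is `true` at two of the four corners.
    face-digit : ∀ v {i j} → i ≢ j → ∀ x →
      bit (y v x) ℕ.+ bit (y (v • i) x) ℕ.+ bit (y (v • i • j) x) ℕ.+ bit (y (v • j) x) ≡ 2
    face-digit v {i} {j} i≢j x = trans
      (cong₂ ℕ._+_ (cong₂ ℕ._+_ (cong (λ a → bit (y v x) ℕ.+ bit a) (y-• v i x)) (cong bit (y-•• v i j x))) (cong bit (y-• v j x)))
      (digits (y v x) (δ i x) (δ j x) λ p q → i≢j (trans (δ⇒≡ i x p) (sym (δ⇒≡ j x q))))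
      where
      digits : ∀ a d e → (d ≡ true → e ≢ true) →
               bit a ℕ.+ bit (a xor not d) ℕ.+ bit (a xor (d xor e)) ℕ.+ bit (a xor not e) ≡ 2
      digits a     true  true  ne = ⊥-elim (ne refl refl)
      digits false false false ne = refl
      digits false false true  ne = refl
      digits false true  false ne = refl
      digits true  false false ne = refl
      digits true  false true  ne = refl
      digits true  true  false ne = refl

    -- The 4 arises because entries start at 1; each power of 2 occurs at two corners. In closed
    -- form the constant is 2(4ᵐ + 1).
    magic-standard : Magic (4 ℕ.+ Σℕ.sum {n} (λ i → 2 * powersOf2 i)) (suc ∘ toℕ ∘ Inverse.to standard)
    magic-standard v {i} {j} i≢j = begin
      suc (N v) ℕ.+ suc (N (v • i)) ℕ.+ suc (N (v • i • j)) ℕ.+ suc (N (v • j))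
        ≡⟨ solve 4 (λ a b c d → con 1 :+ a :+ (con 1 :+ b) :+ (con 1 :+ c) :+ (con 1 :+ d) := con 4 :+ (a :+ b :+ c :+ d)) refl
             (N v) (N (v • i)) (N (v • i • j)) (N (v • j)) ⟩
      4 ℕ.+ (N v ℕ.+ N (v • i) ℕ.+ N (v • i • j) ℕ.+ N (v • j))
        ≡⟨ cong (4 ℕ.+_) (cong₂ ℕ._+_ (cong₂ ℕ._+_ (cong₂ ℕ._+_ (toℕ-standard v) (toℕ-standard (v • i))) (toℕ-standard (v • i • j))) (toℕ-standard (v • j))) ⟩
      4 ℕ.+ (Σℕ.sum (T v) ℕ.+ Σℕ.sum (T (v • i)) ℕ.+ Σℕ.sum (T (v • i • j)) ℕ.+ Σℕ.sum (T (v • j)))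
        ≡⟨ cong (4 ℕ.+_) (begin
             Σℕ.sum (T v) ℕ.+ Σℕ.sum (T (v • i)) ℕ.+ Σℕ.sum (T (v • i • j)) ℕ.+ Σℕ.sum (T (v • j))
               ≡⟨ cong (λ s → s ℕ.+ Σℕ.sum (T (v • i • j)) ℕ.+ Σℕ.sum (T (v • j))) (Σℕ.∑-distrib-+ (T v) (T (v • i))) ⟨
             Σℕ.sum (λ k → T v k ℕ.+ T (v • i) k) ℕ.+ Σℕ.sum (T (v • i • j)) ℕ.+ Σℕ.sum (T (v • j))
               ≡⟨ cong (ℕ._+ Σℕ.sum (T (v • j))) (Σℕ.∑-distrib-+ (λ k → T v k ℕ.+ T (v • i) k) (T (v • i • j))) ⟨
             Σℕ.sum (λ k → T v k ℕ.+ T (v • i) k ℕ.+ T (v • i • j) k) ℕ.+ Σℕ.sum (T (v • j))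
               ≡⟨ Σℕ.∑-distrib-+ (λ k → T v k ℕ.+ T (v • i) k ℕ.+ T (v • i • j) k) (T (v • j)) ⟨
             Σℕ.sum (λ k → T v k ℕ.+ T (v • i) k ℕ.+ T (v • i • j) k ℕ.+ T (v • j) k)
               ≡⟨ Σℕ.sum-cong-≗ (λ k → trans
                    (solve 5 (λ a b c d p → a :* p :+ b :* p :+ c :* p :+ d :* p := (a :+ b :+ c :+ d) :* p) refl
                      (bit (y v (suc k))) (bit (y (v • i) (suc k))) (bit (y (v • i • j) (suc k))) (bit (y (v • j) (suc k))) (powersOf2 k))
                    (cong (_* powersOf2 k) (face-digit v i≢j (suc k)))) ⟩
             Σℕ.sum {n} (λ k → 2 * powersOf2 k) ∎) ⟩
      4 ℕ.+ Σℕ.sum {n} (λ k → 2 * powersOf2 k) ∎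
      where
      N : V → ℕ
      N v = toℕ (Inverse.to standard v)
      T : V → Fin n → ℕ
      T v k = bit (y v (suc k)) * powersOf2 k

-- Weights whose subset sums are exactly 0, ..., 2ᵏ - 1

subsetSum-remove : ∀ {k} (b : Fin (suc k) → ℕ) w i →
                   subsetSum b w ≡ bit (w i) * b i ℕ.+ subsetSum (removeAt b i) (removeAt w i)
subsetSum-remove b w i = Σℕ.sum-remove (λ j → bit (w j) * b j)

subsetSum-insert : ∀ {k} (b : Fin (suc k) → ℕ) w i a →
                   subsetSum b (insertAt w i a) ≡ bit a * b i ℕ.+ subsetSum (removeAt b i) w
subsetSum-insert b w i a = trans (subsetSum-remove b (insertAt w i a) i)
  (cong₂ (λ x s → bit x * b i ℕ.+ s) (insertAt-lookup w i a)
    (subsetSum-cong {b = removeAt b i} (λ _ → refl) (insertAt-punchIn w i a)))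

subsetSum-∅ : ∀ {k} (b : Fin k → ℕ) → subsetSum b (λ _ → false) ≡ 0
subsetSum-∅ {zero}  b = refl
subsetSum-∅ {suc k} b = subsetSum-∅ (b ∘ suc)

subsetSum-δ : ∀ {k} (b : Fin k → ℕ) i → subsetSum b (δ i) ≡ b i
subsetSum-δ b zero    = trans (cong₂ ℕ._+_ (ℕ.+-identityʳ (b zero)) (subsetSum-∅ (b ∘ suc))) (ℕ.+-identityʳ (b zero))
subsetSum-δ b (suc i) = subsetSum-δ (b ∘ suc) i

subsetSum≡1 : ∀ {k} (b : Fin k → ℕ) w → subsetSum b w ≡ 1 → ∃[ i ] b i ≡ 1
subsetSum≡1 {suc k} b w e with w zero | b zero in b₀
... | false | _ with i , bᵢ ← subsetSum≡1 (b ∘ suc) (w ∘ suc) e = suc i , bᵢ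
... | true | 0 with i , bᵢ ← subsetSum≡1 (b ∘ suc) (w ∘ suc) e = suc i , bᵢ
... | true | 1 = zero , b₀

-- Some weight is 1, and the remaining weights have even subset sums: if s is
-- one of these, then s - 1 must arise with the weight 1, so s - 2 is also one.
-- Halve the remaining weights and recurse.
powersOf2-unique : ∀ k (b : Fin k → ℕ) →
  (∀ w → subsetSum b w < 2 ^ k) →
  (∀ v w → subsetSum b v ≡ subsetSum b w → ∀ i → v i ≡ w i) →
  (∀ s → s < 2 ^ k → ∃[ w ] subsetSum b w ≡ s) →
  Σ[ π ∈ Permutation′ k ] ∀ i → b (π ⟨$⟩ʳ i) ≡ powersOf2 i
powersOf2-unique zero    b bounded injective surjective = Perm.id , λ ()
powersOf2-unique (suc k) b bounded injective surjective = insert zero i π , powers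
  where
  one : ∃[ i ] b i ≡ 1
  one with w , e ← surjective 1 (ℕ.*-monoʳ-≤ 2 (ℕ.m^n>0 2 k)) = subsetSum≡1 b w e

  i = proj₁ one
  c = removeAt b i

  with-i : ∀ w a → subsetSum b (insertAt w i a) ≡ bit a ℕ.+ subsetSum c w
  with-i w a = trans (subsetSum-insert b w i a)
    (cong (ℕ._+ subsetSum c w) (trans (cong (bit a *_) (proj₂ one)) (ℕ.*-identityʳ (bit a))))

  -- Such a number would be a subset sum of b in two ways, without the weight 1 at i and with it.
  clash : ∀ v w → subsetSum c v ≢ suc (subsetSum c w)
  clash v w e with () ← trans (sym (insertAt-lookup v i false))
    (trans (injective (insertAt v i false) (insertAt w i true)
              (trans (with-i v false) (trans e (sym (with-i w true)))) i)
           (insertAt-lookup w i true))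

  split : ∀ s → s < 2 ^ suc k → ∃[ a ] ∃[ w ] s ≡ bit a ℕ.+ subsetSum c w
  split s s< with w , e ← surjective s s< = w i , removeAt w i ,
    trans (sym e) (trans (subsetSum-remove b w i)
      (cong (ℕ._+ subsetSum c (removeAt w i)) (trans (cong (bit (w i) *_) (proj₂ one)) (ℕ.*-identityʳ _))))

  c-bounded : ∀ w → subsetSum c w < 2 ^ suc k
  c-bounded w = subst (_< 2 ^ suc k) (with-i w false) (bounded (insertAt w i false))

  even : ∀ s w → subsetSum c w ≡ s → ∃[ h ] s ≡ 2 * h
  even 0 w e = 0 , refl
  even 1 w e = ⊥-elim (clash w (λ _ → false) (trans e (cong suc (sym (subsetSum-∅ c)))))
  even (suc (suc s)) w e with split (suc s) (ℕ.<-trans (ℕ.n<1+n (suc s)) (subst (_< 2 ^ suc k) e (c-bounded w)))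
  ... | false , v , e′ = ⊥-elim (clash w v (trans e (cong suc e′)))
  ... | true  , v , e′ with h , e″ ← even s v (sym (ℕ.suc-injective e′)) =
    suc h , trans (cong (λ x → suc (suc x)) e″)
                  (solve 1 (λ h → con 2 :+ con 2 :* h := con 2 :* (con 1 :+ h)) refl h)

  half : ∀ j → ∃[ h ] c j ≡ 2 * h
  half j = even (c j) (δ j) (subsetSum-δ c j)

  d : Fin k → ℕ
  d j = proj₁ (half j)

  double : ∀ w → subsetSum c w ≡ 2 * subsetSum d w
  double w = trans (subsetSum-cong {w = w} (proj₂ ∘ half) (λ _ → refl)) (subsetSum-*ˡ 2 d w)

  d-injective : ∀ v w → subsetSum d v ≡ subsetSum d w → ∀ j → v j ≡ w j
  d-injective v w e j = trans (sym (insertAt-punchIn v i false j))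
    (trans (injective (insertAt v i false) (insertAt w i false)
      (trans (with-i v false) (trans (double v) (trans (cong (2 *_) e)
        (trans (sym (double w)) (sym (with-i w false)))))) (punchIn i j))
      (insertAt-punchIn w i false j))

  d-surjective : ∀ s → s < 2 ^ k → ∃[ w ] subsetSum d w ≡ s
  d-surjective s s< with split (2 * s) (ℕ.*-monoʳ-< 2 s<)
  ... | false , w , e = w , ℕ.*-cancelˡ-≡ _ _ 2 (trans (sym (double w)) (sym e))
  ... | true  , w , e = ⊥-elim (ℕ.even≢odd s (subsetSum d w) (trans e (cong suc (double w))))

  rec : Σ[ π ∈ Permutation′ k ] ∀ j → d (π ⟨$⟩ʳ j) ≡ powersOf2 j
  rec = powersOf2-unique k d
    (λ w → ℕ.*-cancelˡ-< 2 _ _ (subst (_< 2 ^ suc k) (double w) (c-bounded w)))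
    d-injective d-surjective

  π = proj₁ rec

  powers : ∀ j → b (insert zero i π ⟨$⟩ʳ j) ≡ powersOf2 j
  powers zero    = proj₂ one
  powers (suc j) = trans (proj₂ (half (π ⟨$⟩ʳ j))) (cong (2 *_) (proj₂ rec j))

-- Signed sums and deviations from the mean

open ℤSolver.+-*-Solver using ()
  renaming (solve to solveℤ; _:+_ to _⊕_; _:*_ to _⊗_; _:-_ to _⊖_; :-_ to ⊝_; _:=_ to _⊜_; con to conℤ)

module Σℤ = Sum ℤ.+-0-commutativeMonoid

private
  2z≡0⇒z≡0 : ∀ z → z ℤ.+ z ≡ ℤ.0ℤ → z ≡ ℤ.0ℤ
  2z≡0⇒z≡0 (+ zero)  e = refl
  2z≡0⇒z≡0 (+ suc k) ()
  2z≡0⇒z≡0 -[1+ k ]  ()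

sum-const : ∀ k z → Σℤ.sum {k} (λ _ → z) ≡ + k ℤ.* z
sum-const zero    z = sym (ℤ.*-zeroˡ z)
sum-const (suc k) z = trans (cong (ℤ._+_ z) (sum-const k z)) (sym (ℤ.suc-* (+ k) z))

sum-pos : ∀ {k} (f : Fin k → ℕ) → Σℤ.sum (λ i → + f i) ≡ + Σℕ.sum f
sum-pos {zero}  f = refl
sum-pos {suc k} f = trans (cong (ℤ._+_ (+ f zero)) (sum-pos (f ∘ suc))) (sym (ℤ.pos-+ (f zero) _))

sum-neg : ∀ {k} (f : Fin k → ℤ) → Σℤ.sum (λ i → ℤ.- f i) ≡ ℤ.- Σℤ.sum f
sum-neg {zero}  f = refl
sum-neg {suc k} f = trans (cong (ℤ._+_ (ℤ.- f zero)) (sum-neg (f ∘ suc))) (sym (ℤ.neg-distrib-+ (f zero) _))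

signed : Bool → ℤ → ℤ
signed false z = z
signed true  z = ℤ.- z

signed-xor : ∀ a b z → signed (a xor b) z ≡ signed b (signed a z)
signed-xor false b     z = refl
signed-xor true  false z = refl
signed-xor true  true  z = sym (ℤ.neg-involutive z)

sum-signed : ∀ {k} b (f : Fin k → ℤ) → Σℤ.sum (signed b ∘ f) ≡ signed b (Σℤ.sum f)
sum-signed false f = refl
sum-signed true  f = sum-neg f

nonNegative : ℤ → Bool
nonNegative (+ _)    = true
nonNegative -[1+ _ ] = false

-- Adding the absolute value turns ±z into 0 or twice that value. Summed up, this turns a signed sum
-- into a shifted subset sum.
signed+∣∣ : ∀ a z → signed a z ℤ.+ + ∣ z ∣ ≡ + (bit (a xor nonNegative z) ℕ.* (2 ℕ.* ∣ z ∣))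
signed+∣∣ false (+ k)    = trans (sym (ℤ.pos-+ k k)) (cong +_ (twice k))
  where
  twice : ∀ k → k ℕ.+ k ≡ 1 ℕ.* (2 ℕ.* k)
  twice k = trans (cong (ℕ._+_ k) (sym (ℕ.+-identityʳ k))) (sym (ℕ.+-identityʳ (2 ℕ.* k)))
signed+∣∣ false -[1+ k ] = ℤ.+-inverseˡ (+ suc k)
signed+∣∣ true  (+ k)    = ℤ.+-inverseˡ (+ k)
signed+∣∣ true  -[1+ k ] = signed+∣∣ false (+ suc k)

-- Twice the deviation of k from the mean of 0, …, N - 1.
deviation : ∀ {N} → Fin N → ℤ
deviation k = + toℕ k ℤ.- + toℕ (opposite k)

deviation-opposite : ∀ {N} (k : Fin N) → deviation (opposite k) ≡ ℤ.- deviation k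
deviation-opposite k = trans
  (cong (λ j → + toℕ (opposite k) ℤ.- + toℕ j) (Fin.opposite-involutive k))
  (solveℤ 2 (λ a b → b ⊖ a ⊜ ⊝ (a ⊖ b)) refl (+ toℕ k) (+ toℕ (opposite k)))

toℕ-opposite : ∀ {N} (k : Fin N) → + toℕ (opposite k) ≡ + N ℤ.- + suc (toℕ k)
toℕ-opposite {N} k = trans (cong +_ (Fin.opposite-prop k))
  (trans (sym (ℤ.⊖-≥ (Fin.toℕ<n k))) (sym (ℤ.m-n≡m⊖n N (suc (toℕ k)))))

deviation-toℕ : ∀ {N} (k : Fin N) → deviation k ≡ + 2 ℤ.* + toℕ k ℤ.- (+ N ℤ.- + 1)
deviation-toℕ {N} k = trans (cong (λ z → + toℕ k ℤ.- z) (toℕ-opposite k))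
  (solveℤ 2 (λ k N → k ⊖ (N ⊖ (conℤ (+ 1) ⊕ k)) ⊜ conℤ (+ 2) ⊗ k ⊖ (N ⊖ conℤ (+ 1))) refl (+ toℕ k) (+ N))

sum-deviation : ∀ N → Σℤ.sum {N} deviation ≡ ℤ.0ℤ
sum-deviation N = 2z≡0⇒z≡0 _ (begin
  Σℤ.sum {N} deviation ℤ.+ Σℤ.sum {N} deviation
    ≡⟨ cong (ℤ._+_ (Σℤ.sum {N} deviation)) (trans (Σℤ.sum-permute {N} {N} deviation reverse)
         (trans (Σℤ.sum-cong-≗ {N} deviation-opposite) (sum-neg {N} deviation))) ⟩
  Σℤ.sum {N} deviation ℤ.+ ℤ.- Σℤ.sum {N} deviation
    ≡⟨ ℤ.+-inverseʳ (Σℤ.sum {N} deviation) ⟩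
  ℤ.0ℤ ∎)

parity-≢ : ∀ {k} (u w : Fin k → Bool) → par u ≢ par w → ∃[ i ] u i ≢ w i
parity-≢ {k} u w ne = Fin.¬∀⟶∃¬ k (λ i → u i ≡ w i) (λ i → u i Bool.≟ w i) (ne ∘ Σ₂.sum-cong-≗)

sum≡0 : ∀ {k} (f : Fin k → ℕ) → Σℕ.sum f ≡ 0 → ∀ i → f i ≡ 0
sum≡0 f e zero    = ℕ.m+n≡0⇒m≡0 (f zero) e
sum≡0 f e (suc i) = sum≡0 (f ∘ suc) (ℕ.m+n≡0⇒n≡0 (f zero) e) i

subsetSum≡0 : ∀ {k} (b : Fin k → ℕ) w → subsetSum b w ≡ 0 → ∀ i → w i ≡ true → b i ≡ 0
subsetSum≡0 b w e i wᵢ = trans (sym (ℕ.*-identityˡ (b i)))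
  (trans (cong (λ a → bit a ℕ.* b i) (sym wᵢ)) (sum≡0 (λ i → bit (w i) ℕ.* b i) e i))

-- Summing the identity over all k gives N κ on one side and four rearrangements of the vanishing
-- sum of h on the other.
const-orbit-sum≡0 : ∀ {N} (h : Fin N → ℤ) (π ρ τ : Permutation′ N) κ → 0 < N → Σℤ.sum h ≡ ℤ.0ℤ →
                    (∀ k → h k ℤ.+ h (π ⟨$⟩ʳ k) ℤ.+ h (ρ ⟨$⟩ʳ k) ℤ.+ h (τ ⟨$⟩ʳ k) ≡ κ) → κ ≡ ℤ.0ℤ
const-orbit-sum≡0 {N} h π ρ τ κ 0<N sum≡0 const =
  Sum⊎.[ ⊥-elim ∘ N≢0 , (λ e → e) ] (ℤ.i*j≡0⇒i≡0∨j≡0 (+ N) {κ} Nκ≡0)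
  where
  N≢0 : + N ≢ ℤ.0ℤ
  N≢0 e = ℕ.<⇒≢ 0<N (sym (ℤ.+-injective e))
  permuted : (π : Permutation′ N) → Σℤ.sum (λ k → h (π ⟨$⟩ʳ k)) ≡ ℤ.0ℤ
  permuted π = trans (sym (Σℤ.sum-permute h π)) sum≡0
  b c d : Fin N → ℤ
  b k = h (π ⟨$⟩ʳ k)
  c k = h (ρ ⟨$⟩ʳ k)
  d k = h (τ ⟨$⟩ʳ k)
  Nκ≡0 : + N ℤ.* κ ≡ ℤ.0ℤ
  Nκ≡0 = begin
    + N ℤ.* κ
      ≡⟨ sum-const N κ ⟨
    Σℤ.sum {N} (λ _ → κ)
      ≡⟨ Σℤ.sum-cong-≗ const ⟨
    Σℤ.sum (λ k → h k ℤ.+ b k ℤ.+ c k ℤ.+ d k)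
      ≡⟨ Σℤ.∑-distrib-+ (λ k → h k ℤ.+ b k ℤ.+ c k) d ⟩
    Σℤ.sum (λ k → h k ℤ.+ b k ℤ.+ c k) ℤ.+ Σℤ.sum d
      ≡⟨ cong (ℤ._+ Σℤ.sum d) (Σℤ.∑-distrib-+ (λ k → h k ℤ.+ b k) c) ⟩
    Σℤ.sum (λ k → h k ℤ.+ b k) ℤ.+ Σℤ.sum c ℤ.+ Σℤ.sum d
      ≡⟨ cong (λ z → z ℤ.+ Σℤ.sum c ℤ.+ Σℤ.sum d) (Σℤ.∑-distrib-+ h b) ⟩
    Σℤ.sum h ℤ.+ Σℤ.sum b ℤ.+ Σℤ.sum c ℤ.+ Σℤ.sum d
      ≡⟨ cong₂ ℤ._+_ (cong₂ ℤ._+_ (cong₂ ℤ._+_ sum≡0 (permuted π)) (permuted ρ)) (permuted τ) ⟩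
    ℤ.0ℤ ∎

-- Uniqueness: every magic labelling is equivalent to the standard one

module Uniqueness (m′ : ℕ) where
  m : ℕ
  m = suc m′

  open FoldedCube m
  open Magic m
  open Existence m

  N : ℕ
  N = 4 ℕ.^ m

  module _ (B : V ↔ Fin N) {c} (magic : Magic c (suc ∘ toℕ ∘ Inverse.to B)) where
    open Inverse B using (to; from; strictlyInverseˡ; strictlyInverseʳ)

    private
      H : V → ℤ
      H v = deviation (to v)

    abstract
      -- In terms of the entry x the deviation is 2x - (N + 1); four of these are added.
      H-face-const : ∀ v {i j} → i ≢ j →
        H v ℤ.+ H (v • i) ℤ.+ H (v • i • j) ℤ.+ H (v • j) ≡ + 2 ℤ.* + c ℤ.- + 4 ℤ.* (+ N ℤ.+ + 1)
      H-face-const v {i} {j} i≢j = begin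
        H v ℤ.+ H (v • i) ℤ.+ H (v • i • j) ℤ.+ H (v • j)
          ≡⟨ cong₂ ℤ._+_ (cong₂ ℤ._+_ (cong₂ ℤ._+_ (dev v) (dev (v • i))) (dev (v • i • j))) (dev (v • j)) ⟩
        (+ 2 ℤ.* K v ℤ.- N-1) ℤ.+ (+ 2 ℤ.* K (v • i) ℤ.- N-1) ℤ.+ (+ 2 ℤ.* K (v • i • j) ℤ.- N-1) ℤ.+ (+ 2 ℤ.* K (v • j) ℤ.- N-1)
          ≡⟨ solveℤ 5 (λ a b c d N →
               (conℤ (+ 2) ⊗ a ⊖ (N ⊖ conℤ (+ 1))) ⊕ (conℤ (+ 2) ⊗ b ⊖ (N ⊖ conℤ (+ 1))) ⊕
               (conℤ (+ 2) ⊗ c ⊖ (N ⊖ conℤ (+ 1))) ⊕ (conℤ (+ 2) ⊗ d ⊖ (N ⊖ conℤ (+ 1))) ⊜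
               conℤ (+ 2) ⊗ ((conℤ (+ 1) ⊕ a) ⊕ (conℤ (+ 1) ⊕ b) ⊕ (conℤ (+ 1) ⊕ c) ⊕ (conℤ (+ 1) ⊕ d)) ⊖ conℤ (+ 4) ⊗ (N ⊕ conℤ (+ 1)))
               refl (K v) (K (v • i)) (K (v • i • j)) (K (v • j)) (+ N) ⟩
        + 2 ℤ.* ((+ 1 ℤ.+ K v) ℤ.+ (+ 1 ℤ.+ K (v • i)) ℤ.+ (+ 1 ℤ.+ K (v • i • j)) ℤ.+ (+ 1 ℤ.+ K (v • j))) ℤ.- + 4 ℤ.* (+ N ℤ.+ + 1)
          ≡⟨ cong (λ z → + 2 ℤ.* z ℤ.- + 4 ℤ.* (+ N ℤ.+ + 1)) (cong +_ (magic v i≢j)) ⟩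
        + 2 ℤ.* + c ℤ.- + 4 ℤ.* (+ N ℤ.+ + 1) ∎
        where
        K : V → ℤ
        K v = + toℕ (to v)
        N-1 : ℤ
        N-1 = + N ℤ.- + 1
        dev : ∀ v → H v ≡ + 2 ℤ.* K v ℤ.- N-1
        dev v = deviation-toℕ (to v)

      private
        κ : ℤ
        κ = + 2 ℤ.* + c ℤ.- + 4 ℤ.* (+ N ℤ.+ + 1)

        shift : (i : Fin (suc n)) → V ↔ V
        shift i = mk↔ₛ′ (_• i) (_• i) (λ v → •-involutive v i) (λ v → •-involutive v i)

        conjugate : V ↔ V → Permutation′ N
        conjugate π = B ↔-∘ (π ↔-∘ ↔-sym B)

        -- Averaging over the faces with directions `zero` and `suc zero` determines the constant;
        -- both directions exist because m is positive.
        κ≡0 : κ ≡ ℤ.0ℤ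
        κ≡0 = const-orbit-sum≡0 deviation
          (conjugate (shift zero)) (conjugate (shift (suc zero) ↔-∘ shift zero)) (conjugate (shift (suc zero)))
          κ (ℕ.m^n>0 4 m) (sum-deviation N)
          λ k → trans (cong (λ j → deviation j ℤ.+ H (from k • zero) ℤ.+ H (from k • zero • suc zero) ℤ.+ H (from k • suc zero))
                            (sym (strictlyInverseˡ k)))
                      (H-face-const (from k) {zero} {suc zero} λ ())

      H-face : ∀ v {i j} → i ≢ j → H v ℤ.+ H (v • i) ℤ.+ H (v • i • j) ℤ.+ H (v • j) ≡ ℤ.0ℤ
      H-face v i≢j = trans (H-face-const v i≢j) κ≡0

    private
      D : Fin (suc n) → V → ℤ
      D i v = H v ℤ.+ H (v • i)

      d : Fin (suc n) → ℤ
      d i = D i 𝟎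

    abstract
      -- The two edges in direction i of a face carry opposite sums, since the face sums to 0.
      D-flip : ∀ i v {j} → i ≢ j → D i (v • j) ≡ ℤ.- D i v
      D-flip i v {j} i≢j = begin
        H (v • j) ℤ.+ H (v • j • i)                          ≡⟨ cong (λ x → H (v • j) ℤ.+ H x) (•-comm v j i) ⟩
        H (v • j) ℤ.+ H (v • i • j)
          ≡⟨ solveℤ 4 (λ a b c d → d ⊕ c ⊜ (a ⊕ b ⊕ c ⊕ d) ⊕ ⊝ (a ⊕ b)) refl (H v) (H (v • i)) (H (v • i • j)) (H (v • j)) ⟩
        (H v ℤ.+ H (v • i) ℤ.+ H (v • i • j) ℤ.+ H (v • j)) ℤ.+ ℤ.- D i v
          ≡⟨ cong (ℤ._+ ℤ.- D i v) (H-face v i≢j) ⟩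
        ℤ.0ℤ ℤ.+ ℤ.- D i v                                   ≡⟨ ℤ.+-identityˡ _ ⟩
        ℤ.- D i v                                            ∎

      D-fixed : ∀ i v → D i (v • i) ≡ D i v
      D-fixed i v = trans (cong (λ x → H (v • i) ℤ.+ H x) (•-involutive v i)) (ℤ.+-comm (H (v • i)) (H v))

      -- The steps that reverse the sign of `D i` are those in directions other than i, exactly the
      -- ones that toggle coordinate i of y.
      D-y : ∀ i v → D i v ≡ signed (y v i) (d i)
      D-y i v = •-induction (λ v → D i v ≡ signed (y v i) (d i)) step 𝟎 v
        (sym (cong (λ b → signed b (d i)) (y-𝟎 i)))
        where
        flipped : ∀ v j → D i (v • j) ≡ signed (not (δ j i)) (D i v)
        flipped v j with j Fin.≟ i
        ... | yes refl = trans (D-fixed i v) (cong (λ b → signed (not b) (D i v)) (sym (δ-refl i)))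
        ... | no j≢i   = trans (D-flip i v (j≢i ∘ sym)) (cong (λ b → signed (not b) (D i v)) (sym (δ-≢ j≢i)))
        step : ∀ v j → D i v ≡ signed (y v i) (d i) → D i (v • suc j) ≡ signed (y (v • suc j) i) (d i)
        step v j e = begin
          D i (v • suc j)                                   ≡⟨ flipped v (suc j) ⟩
          signed (not (δ (suc j) i)) (D i v)                ≡⟨ cong (signed (not (δ (suc j) i))) e ⟩
          signed (not (δ (suc j) i)) (signed (y v i) (d i)) ≡⟨ signed-xor (y v i) (not (δ (suc j) i)) (d i) ⟨
          signed (y v i xor not (δ (suc j) i)) (d i)        ≡⟨ cong (λ b → signed b (d i)) (y-• v (suc j) i) ⟨
          signed (y (v • suc j) i) (d i)                    ∎

    -- The defect E changes sign along every edge.  As the antipode of v is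
    -- reached from v by an even number of flips, but also by one edge of FQ,
    -- E vanishes.
    private
      E : V → ℤ
      E v = H v ℤ.+ H v ℤ.- Σℤ.sum (λ i → D i v)

    abstract
      -- Among the edge sums at v only that of direction j is kept, and it is `H v` + `H (v • j)`;
      -- all the others change sign.
      E-flip : ∀ v j → E (v • j) ≡ ℤ.- E v
      E-flip v j = begin
        H (v • j) ℤ.+ H (v • j) ℤ.- Σℤ.sum (λ i → D i (v • j))
          ≡⟨ cong (λ z → H (v • j) ℤ.+ H (v • j) ℤ.- z) (begin
               Σℤ.sum (λ i → D i (v • j))
                 ≡⟨ Σℤ.sum-remove {i = j} (λ i → D i (v • j)) ⟩
               D j (v • j) ℤ.+ Σℤ.sum (removeAt (λ i → D i (v • j)) j)
                 ≡⟨ cong₂ ℤ._+_ (D-fixed j v) (trans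
                      (Σℤ.sum-cong-≗ {n} (λ k → D-flip (punchIn j k) v (Fin.punchInᵢ≢i j k)))
                      (sum-neg (removeAt (λ i → D i v) j))) ⟩
               D j v ℤ.+ ℤ.- rest ∎) ⟩
        H (v • j) ℤ.+ H (v • j) ℤ.- ((H v ℤ.+ H (v • j)) ℤ.+ ℤ.- rest)
          ≡⟨ solveℤ 3 (λ a b r → b ⊕ b ⊖ ((a ⊕ b) ⊕ ⊝ r) ⊜ ⊝ (a ⊕ a ⊖ ((a ⊕ b) ⊕ r))) refl (H v) (H (v • j)) rest ⟩
        ℤ.- (H v ℤ.+ H v ℤ.- (D j v ℤ.+ rest))
          ≡⟨ cong (λ z → ℤ.- (H v ℤ.+ H v ℤ.- z)) (Σℤ.sum-remove {i = j} (λ i → D i v)) ⟨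
        ℤ.- E v ∎
        where
        rest : ℤ
        rest = Σℤ.sum (removeAt (λ i → D i v) j)

      E≡0 : ∀ v → E v ≡ ℤ.0ℤ
      E≡0 v = 2z≡0⇒z≡0 (E v) (trans (cong (ℤ._+ E v) (begin
        E v                                          ≡⟨ cong (λ b → signed b (E v)) (trans (cong (y v zero xor_) (trans (y-• v zero zero) (Bool.xor-identityʳ _))) (Bool.xor-same (y v zero))) ⟨
        signed (y v zero xor y (v • zero) zero) (E v) ≡⟨ along (v • zero) ⟨
        E (v • zero)                                 ≡⟨ E-flip v zero ⟩
        ℤ.- E v                                      ∎)) (ℤ.+-inverseˡ (E v)))
        where
        step : ∀ w j → E w ≡ signed (y v zero xor y w zero) (E v) →
               E (w • suc j) ≡ signed (y v zero xor y (w • suc j) zero) (E v)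
        step w j e = begin
          E (w • suc j)                                         ≡⟨ E-flip w (suc j) ⟩
          signed true (E w)                                     ≡⟨ cong (signed true) e ⟩
          signed true (signed (y v zero xor y w zero) (E v))    ≡⟨ signed-xor (y v zero xor y w zero) true (E v) ⟨
          signed ((y v zero xor y w zero) xor true) (E v)       ≡⟨ cong (λ b → signed b (E v)) (Bool.xor-assoc (y v zero) (y w zero) true) ⟩
          signed (y v zero xor (y w zero xor true)) (E v)       ≡⟨ cong (λ b → signed (y v zero xor b) (E v)) (y-• w (suc j) zero) ⟨
          signed (y v zero xor y (w • suc j) zero) (E v)        ∎
        along : ∀ w → E w ≡ signed (y v zero xor y w zero) (E v)
        along w = •-induction (λ w → E w ≡ signed (y v zero xor y w zero) (E v)) step v w
          (sym (cong (λ b → signed b (E v)) (Bool.xor-same (y v zero))))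

    private
      -- Defined on odd vectors too, so that it can be minimised over all sign patterns.
      Λ : (Fin (suc n) → Bool) → ℤ
      Λ u = Σℤ.sum λ i → signed (u i) (d i)

    abstract
      H-Λ : ∀ v → H v ℤ.+ H v ≡ Λ (y v)
      H-Λ v = trans
        (solveℤ 2 (λ a b → a ⊜ (a ⊖ b) ⊕ b) refl (H v ℤ.+ H v) (Σℤ.sum (λ i → D i v)))
        (trans (cong₂ ℤ._+_ (E≡0 v) (Σℤ.sum-cong-≗ {suc n} (λ i → D-y i v))) (ℤ.+-identityˡ (Λ (y v))))

      Λ-xor : ∀ u b → Λ (λ i → u i xor b) ≡ signed b (Λ u)
      Λ-xor u b = trans (Σℤ.sum-cong-≗ {suc n} (λ i → signed-xor (u i) b (d i)))
                        (sum-signed {suc n} b (λ i → signed (u i) (d i)))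

      H-q : ∀ u → H (q u) ℤ.+ H (q u) ≡ signed (par u) (Λ u)
      H-q u = trans (H-Λ (q u)) (trans
        (Σℤ.sum-cong-≗ {suc n} (λ i → cong (λ b → signed b (d i)) (y-q u i))) (Λ-xor u (par u)))

    private
      -- This sign pattern makes every term of Λ equal to minus its absolute value, so it attains
      -- the minimum -C.
      pos : Fin (suc n) → Bool
      pos i = nonNegative (d i)

      C : ℤ
      C = Σℤ.sum λ i → + ∣ d i ∣

    abstract
      Λ-subsetSum : ∀ u → Λ u ℤ.+ C ≡ + subsetSum (λ i → 2 ℕ.* ∣ d i ∣) (λ i → u i xor pos i)
      Λ-subsetSum u = begin
        Λ u ℤ.+ C
          ≡⟨ Σℤ.∑-distrib-+ {suc n} (λ i → signed (u i) (d i)) (λ i → + ∣ d i ∣) ⟨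
        Σℤ.sum {suc n} (λ i → signed (u i) (d i) ℤ.+ + ∣ d i ∣)
          ≡⟨ Σℤ.sum-cong-≗ {suc n} (λ i → signed+∣∣ (u i) (d i)) ⟩
        Σℤ.sum {suc n} (λ i → + (bit (u i xor pos i) ℕ.* (2 ℕ.* ∣ d i ∣)))
          ≡⟨ sum-pos {suc n} (λ i → bit (u i xor pos i) ℕ.* (2 ℕ.* ∣ d i ∣)) ⟩
        + subsetSum (λ i → 2 ℕ.* ∣ d i ∣) (λ i → u i xor pos i) ∎

    -- The set {H v} is symmetric about 0, so the least value of Λ is attained
    -- both on even and on odd vectors; where two minimisers differ, d vanishes.
    private
      v⁻ : V
      v⁻ = from (opposite (to (q pos)))

      -- Complementing a vector negates Λ and, as n + 1 is odd, switches its parity. The complement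
      -- of `y v⁻` is taken exactly when `pos` is even; in both cases the result has the value of
      -- `pos` and the opposite parity.
      u⁻ : Fin (suc n) → Bool
      u⁻ i = y v⁻ i xor not (par pos)

    abstract
      H-v⁻ : H v⁻ ≡ ℤ.- H (q pos)
      H-v⁻ = trans (cong deviation (strictlyInverseˡ (opposite (to (q pos))))) (deviation-opposite (to (q pos)))

      Λ-u⁻ : Λ u⁻ ≡ Λ pos
      Λ-u⁻ = begin
        Λ u⁻                                             ≡⟨ Λ-xor (y v⁻) (not (par pos)) ⟩
        signed (not (par pos)) (Λ (y v⁻))                ≡⟨ cong (signed (not (par pos))) (begin
          Λ (y v⁻)                                         ≡⟨ H-Λ v⁻ ⟨
          H v⁻ ℤ.+ H v⁻                                    ≡⟨ cong (λ z → z ℤ.+ z) H-v⁻ ⟩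
          ℤ.- H (q pos) ℤ.+ ℤ.- H (q pos)                  ≡⟨ ℤ.neg-distrib-+ (H (q pos)) (H (q pos)) ⟨
          ℤ.- (H (q pos) ℤ.+ H (q pos))                    ≡⟨ cong ℤ.-_ (H-q pos) ⟩
          ℤ.- signed (par pos) (Λ pos)                     ∎) ⟩
        signed (not (par pos)) (ℤ.- signed (par pos) (Λ pos)) ≡⟨ cancel (par pos) (Λ pos) ⟩
        Λ pos                                            ∎
        where
        cancel : ∀ b z → signed (not b) (ℤ.- signed b z) ≡ z
        cancel false z = ℤ.neg-involutive z
        cancel true  z = ℤ.neg-involutive z

      par-u⁻ : par u⁻ ≡ not (par pos)
      par-u⁻ = trans (Σ₂.∑-distrib-+ {suc n} (y v⁻) (λ _ → not (par pos)))
        (cong₂ _xor_ (par-y v⁻) (par-const m (not (par pos))))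

      zero-direction : ∃[ i ] ∣ d i ∣ ≡ 0
      zero-direction = vanishes (parity-≢ u⁻ pos λ e → Bool.not-¬ refl (trans (sym e) par-u⁻))
        where
        minimum≡0 : subsetSum (λ i → 2 ℕ.* ∣ d i ∣) (λ i → u⁻ i xor pos i) ≡ 0
        minimum≡0 = ℤ.+-injective (begin
          + subsetSum (λ i → 2 ℕ.* ∣ d i ∣) (λ i → u⁻ i xor pos i)    ≡⟨ Λ-subsetSum u⁻ ⟨
          Λ u⁻ ℤ.+ C                                                  ≡⟨ cong (ℤ._+ C) Λ-u⁻ ⟩
          Λ pos ℤ.+ C                                                 ≡⟨ Λ-subsetSum pos ⟩
          + subsetSum (λ i → 2 ℕ.* ∣ d i ∣) (λ i → pos i xor pos i)
            ≡⟨ cong +_ (trans (subsetSum-cong {b = λ i → 2 ℕ.* ∣ d i ∣} (λ _ → refl) (λ i → Bool.xor-same (pos i)))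
                              (subsetSum-∅ (λ i → 2 ℕ.* ∣ d i ∣))) ⟩
          + 0                                                         ∎)
        vanishes : ∃[ i ] u⁻ i ≢ pos i → ∃[ i ] ∣ d i ∣ ≡ 0
        vanishes (i , differ) = i , ℕ.m+n≡0⇒m≡0 ∣ d i ∣ {∣ d i ∣ ℕ.+ 0}
          (subsetSum≡0 (λ i → 2 ℕ.* ∣ d i ∣) (λ i → u⁻ i xor pos i) minimum≡0 i
            (trans (cong (_xor pos i) (Bool.¬-not differ)) (Bool.xor-inverseˡ (pos i))))

    -- Entries as subset sums of 2m weights

    private
      i₀ : Fin (suc n)
      i₀ = proj₁ zero-direction

      e : Fin n → ℕ
      e j = ∣ d (punchIn i₀ j) ∣

      t : Fin n → Bool
      t j = pos (punchIn i₀ j)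

      subset : V → Fin n → Bool
      subset v j = y v (punchIn i₀ j) xor t j

      K : V → ℕ
      K v = toℕ (to v)

      -- Coordinate i₀, whose coefficient vanishes, carries the parity, so every subset is realised
      -- by a vertex.
      vertex : (Fin n → Bool) → V
      vertex w = fill i₀ (λ j → w j xor t j)

    abstract
      subset-vertex : ∀ w j → subset (vertex w) j ≡ w j
      subset-vertex w j = trans (cong (_xor t j) (y-fill i₀ (λ j → w j xor t j) j))
        (trans (Bool.xor-assoc (w j) (t j) (t j))
          (trans (cong (w j xor_) (Bool.xor-same (t j))) (Bool.xor-identityʳ (w j))))

      S≡2H : ∀ v → + (2 ℕ.* subsetSum e (subset v)) ≡ (H v ℤ.+ H v) ℤ.+ C
      S≡2H v = begin
        + (2 ℕ.* subsetSum e (subset v))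
          ≡⟨ cong +_ (begin
            2 ℕ.* subsetSum e (subset v)                 ≡⟨ subsetSum-*ˡ 2 e (subset v) ⟨
            subsetSum (λ j → 2 ℕ.* e j) (subset v)       ≡⟨ cong (ℕ._+ subsetSum (λ j → 2 ℕ.* e j) (subset v)) (begin
              bit (y v i₀ xor pos i₀) ℕ.* (2 ℕ.* ∣ d i₀ ∣)    ≡⟨ cong (λ x → bit (y v i₀ xor pos i₀) ℕ.* (2 ℕ.* x)) (proj₂ zero-direction) ⟩
              bit (y v i₀ xor pos i₀) ℕ.* 0                   ≡⟨ ℕ.*-zeroʳ (bit (y v i₀ xor pos i₀)) ⟩
              0                                               ∎) ⟨
            bit (y v i₀ xor pos i₀) ℕ.* (2 ℕ.* ∣ d i₀ ∣) ℕ.+ subsetSum (λ j → 2 ℕ.* e j) (subset v)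
              ≡⟨ subsetSum-remove (λ i → 2 ℕ.* ∣ d i ∣) (λ i → y v i xor pos i) i₀ ⟨
            subsetSum (λ i → 2 ℕ.* ∣ d i ∣) (λ i → y v i xor pos i) ∎) ⟩
        + subsetSum (λ i → 2 ℕ.* ∣ d i ∣) (λ i → y v i xor pos i)
          ≡⟨ Λ-subsetSum (y v) ⟨
        Λ (y v) ℤ.+ C
          ≡⟨ cong (ℤ._+ C) (H-Λ v) ⟨
        (H v ℤ.+ H v) ℤ.+ C ∎

      -- Both subset sums come from 4K by the same shift, which involves C and N; comparing two
      -- vertices cancels it, and adding crosswise stays in ℕ.
      S-difference : ∀ v w → 2 ℕ.* subsetSum e (subset v) ℕ.+ 4 ℕ.* K w ≡ 2 ℕ.* subsetSum e (subset w) ℕ.+ 4 ℕ.* K v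
      S-difference v w = ℤ.+-injective (trans (side v w) (trans
        (solveℤ 4 (λ a b N C → ((conℤ (+ 2) ⊗ a ⊖ N) ⊕ (conℤ (+ 2) ⊗ a ⊖ N)) ⊕ C ⊕ conℤ (+ 4) ⊗ b ⊜
                              ((conℤ (+ 2) ⊗ b ⊖ N) ⊕ (conℤ (+ 2) ⊗ b ⊖ N)) ⊕ C ⊕ conℤ (+ 4) ⊗ a)
               refl (+ K v) (+ K w) (+ N ℤ.- + 1) C)
        (sym (side w v))))
        where
        side : ∀ v w → + (2 ℕ.* subsetSum e (subset v) ℕ.+ 4 ℕ.* K w) ≡
          ((+ 2 ℤ.* + K v ℤ.- (+ N ℤ.- + 1)) ℤ.+ (+ 2 ℤ.* + K v ℤ.- (+ N ℤ.- + 1))) ℤ.+ C ℤ.+ + 4 ℤ.* + K w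
        side v w = trans (ℤ.pos-+ (2 ℕ.* subsetSum e (subset v)) (4 ℕ.* K w))
          (cong₂ ℤ._+_ (trans (S≡2H v) (cong (λ z → z ℤ.+ z ℤ.+ C) (deviation-toℕ (to v)))) (ℤ.pos-* 4 (K w)))

      -- The shift is found by comparing v₀, where the subset sum is 0, with v₁, where K is 0: two
      -- natural numbers then add up to 0, so K is 0 at v₀ as well.
      subsetSum-e : ∀ v → subsetSum e (subset v) ≡ 2 ℕ.* K v
      subsetSum-e v = ℕ.*-cancelˡ-≡ _ _ 2 (begin
        2 ℕ.* subsetSum e (subset v)
          ≡⟨ ℕ.+-identityʳ _ ⟨
        2 ℕ.* subsetSum e (subset v) ℕ.+ 4 ℕ.* 0
          ≡⟨ cong (λ k → 2 ℕ.* subsetSum e (subset v) ℕ.+ 4 ℕ.* k) K-v₀ ⟨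
        2 ℕ.* subsetSum e (subset v) ℕ.+ 4 ℕ.* K v₀
          ≡⟨ S-difference v v₀ ⟩
        2 ℕ.* subsetSum e (subset v₀) ℕ.+ 4 ℕ.* K v
          ≡⟨ cong (λ s → 2 ℕ.* s ℕ.+ 4 ℕ.* K v) S-v₀ ⟩
        4 ℕ.* K v
          ≡⟨ ℕ.*-assoc 2 2 (K v) ⟩
        2 ℕ.* (2 ℕ.* K v) ∎)
        where
        v₀ v₁ : V
        v₀ = vertex (λ _ → false)
        v₁ = from (fromℕ< (ℕ.m^n>0 4 m))
        S-v₀ : subsetSum e (subset v₀) ≡ 0
        S-v₀ = trans (subsetSum-cong {b = e} (λ _ → refl) (subset-vertex (λ _ → false))) (subsetSum-∅ e)
        K-v₁ : K v₁ ≡ 0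
        K-v₁ = trans (cong toℕ (strictlyInverseˡ (fromℕ< (ℕ.m^n>0 4 m)))) (Fin.toℕ-fromℕ< (ℕ.m^n>0 4 m))
        K-v₀ : K v₀ ≡ 0
        K-v₀ = ℕ.m+n≡0⇒m≡0 (K v₀) (ℕ.m+n≡0⇒n≡0 (2 ℕ.* subsetSum e (subset v₁)) (begin
          2 ℕ.* subsetSum e (subset v₁) ℕ.+ 4 ℕ.* K v₀   ≡⟨ S-difference v₁ v₀ ⟩
          2 ℕ.* subsetSum e (subset v₀) ℕ.+ 4 ℕ.* K v₁   ≡⟨ cong₂ (λ a b → 2 ℕ.* a ℕ.+ 4 ℕ.* b) S-v₀ K-v₁ ⟩
          0                                              ∎))

    private
      -- The weights halved. Taking them to be values of K at singleton subsets shows at once that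
      -- each `e j` is even.
      b : Fin n → ℕ
      b j = K (vertex (δ j))

    abstract
      e≡2b : ∀ j → e j ≡ 2 ℕ.* b j
      e≡2b j = begin
        e j                                    ≡⟨ subsetSum-δ e j ⟨
        subsetSum e (δ j)                      ≡⟨ subsetSum-cong {b = e} (λ _ → refl) (subset-vertex (δ j)) ⟨
        subsetSum e (subset (vertex (δ j)))    ≡⟨ subsetSum-e (vertex (δ j)) ⟩
        2 ℕ.* b j                              ∎

      K-subsetSum : ∀ v → K v ≡ subsetSum b (subset v)
      K-subsetSum v = ℕ.*-cancelˡ-≡ _ _ 2 (begin
        2 ℕ.* K v                                    ≡⟨ subsetSum-e v ⟨
        subsetSum e (subset v)                       ≡⟨ subsetSum-cong {w = subset v} e≡2b (λ _ → refl) ⟩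
        subsetSum (λ j → 2 ℕ.* b j) (subset v)       ≡⟨ subsetSum-*ˡ 2 b (subset v) ⟩
        2 ℕ.* subsetSum b (subset v)                 ∎)

      K-vertex : ∀ w → K (vertex w) ≡ subsetSum b w
      K-vertex w = trans (K-subsetSum (vertex w)) (subsetSum-cong {b = b} (λ _ → refl) (subset-vertex w))

      weights : Σ[ π ∈ Permutation′ n ] ∀ i → b (π ⟨$⟩ʳ i) ≡ powersOf2 i
      weights = powersOf2-unique n b bounded injective surjective
        where
        bounded : ∀ w → subsetSum b w < 2 ^ n
        bounded w = subst₂ _<_ (K-vertex w) (sym 2^n≡4^m) (Fin.toℕ<n (to (vertex w)))
        injective : ∀ v w → subsetSum b v ≡ subsetSum b w → ∀ i → v i ≡ w i
        injective v w eq i = trans (sym (subset-vertex v i))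
          (trans (cong (λ x → subset x i) vertices≡) (subset-vertex w i))
          where
          vertices≡ : vertex v ≡ vertex w
          vertices≡ = trans (sym (strictlyInverseʳ (vertex v))) (trans
            (cong from (Fin.toℕ-injective (trans (K-vertex v) (trans eq (sym (K-vertex w))))))
            (strictlyInverseʳ (vertex w)))
        surjective : ∀ s → s < 2 ^ n → ∃[ w ] subsetSum b w ≡ s
        surjective s s< = subset v , trans (sym (K-subsetSum v))
          (trans (cong toℕ (strictlyInverseˡ k)) (Fin.toℕ-fromℕ< s<4^m))
          where
          s<4^m : s < 4 ^ m
          s<4^m = subst (s <_) 2^n≡4^m s<
          k : Fin N
          k = fromℕ< s<4^m
          v : V
          v = from k

    private
      π : Permutation′ n
      π = proj₁ weights

      σ : Permutation′ (suc n)
      σ = insert zero i₀ π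

      -- The inserted entry makes u even, so `act` toggles precisely the coordinates prescribed by
      -- t. The map uses `flip σ` because `act` reads coordinates through the inverse permutation.
      u : Fin (suc n) → Bool
      u = insertAt (t ∘ (π ⟨$⟩ʳ_)) zero (par (t ∘ (π ⟨$⟩ʳ_)))

    toStandard : GraphIso (FQ n) (FQ n)
    toStandard = automorphism u (flip σ)

    abstract
      standard-toStandard : ∀ v → to v ≡ Inverse.to standard (Inverse.to (GraphIso.vertices toStandard) v)
      standard-toStandard v = Fin.toℕ-injective (begin
        K v
          ≡⟨ K-subsetSum v ⟩
        subsetSum b (subset v)
          ≡⟨ Σℕ.sum-permute {n} {n} (λ j → bit (subset v j) ℕ.* b j) π ⟩
        subsetSum (b ∘ (π ⟨$⟩ʳ_)) (subset v ∘ (π ⟨$⟩ʳ_))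
          ≡⟨ subsetSum-cong (proj₂ weights) coordinate ⟩
        subsetSum powersOf2 (y (act u (flip σ) v) ∘ suc)
          ≡⟨ toℕ-standard (act u (flip σ) v) ⟨
        toℕ (Inverse.to standard (act u (flip σ) v)) ∎)
        where
        par-u : par u ≡ false
        par-u = Bool.xor-same (par (t ∘ (π ⟨$⟩ʳ_)))
        coordinate : ∀ k → subset v (π ⟨$⟩ʳ k) ≡ y (act u (flip σ) v) (suc k)
        coordinate k = begin
          y v (punchIn i₀ (π ⟨$⟩ʳ k)) xor t (π ⟨$⟩ʳ k)           ≡⟨ Bool.xor-comm _ (t (π ⟨$⟩ʳ k)) ⟩
          t (π ⟨$⟩ʳ k) xor y v (σ ⟨$⟩ʳ suc k)                    ≡⟨ cong (_xor y v (σ ⟨$⟩ʳ suc k)) (Bool.xor-identityʳ (t (π ⟨$⟩ʳ k))) ⟨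
          (u (suc k) xor false) xor y v (σ ⟨$⟩ʳ suc k)           ≡⟨ cong (λ p → (u (suc k) xor p) xor y v (σ ⟨$⟩ʳ suc k)) par-u ⟨
          (u (suc k) xor par u) xor y v (σ ⟨$⟩ʳ suc k)           ≡⟨ y-act u (flip σ) v (suc k) ⟨
          y (act u (flip σ) v) (suc k)                           ∎

-- Existence, faithfulness and transitivity for the natural action

module _ (m′ : ℕ) (φ : GraphIso (C₄ □^ suc m′) (Q (suc m′ * 2))) where
  open Uniqueness m′ hiding (m; N)
  open FoldedCube (suc m′)
  open Magic (suc m′)
  open Existence (suc m′)
  open Inverse (GraphIso.vertices φ)

  standardArrangement : Arrangement (suc m′)
  standardArrangement = standard ↔-∘ GraphIso.vertices φ

  standardArrangement-compactMagic : IsCompactMagic standardArrangement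
  standardArrangement-compactMagic = magic⇒compactMagic φ standardArrangement
    (magic-cong {F = suc ∘ toℕ ∘ Inverse.to standard}
      (λ v → cong (suc ∘ toℕ ∘ Inverse.to standard) (sym (strictlyInverseˡ v)))
      magic-standard)

  -- The entries of the standard arrangement are pairwise different, so fixing it already forces g
  -- to fix every vertex.
  faithful : FaithfulOn (naturalAction φ) IsCompactMagic
  faithful g fixes v = trans (cong (Inverse.to (GraphIso.vertices g)) (sym (g⁻¹-fixes v)))
                             (Inverse.strictlyInverseˡ (GraphIso.vertices g) v)
    where
    g⁻¹ : V → V
    g⁻¹ = Inverse.from (GraphIso.vertices g)
    A : V → Fin (4 ^ suc m′)
    A = Inverse.to standard
    g⁻¹-fixes : ∀ v → g⁻¹ v ≡ v
    g⁻¹-fixes v = begin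
      g⁻¹ v                                 ≡⟨ Inverse.strictlyInverseʳ standard (g⁻¹ v) ⟨
      Inverse.from standard (A (g⁻¹ v))     ≡⟨ cong (Inverse.from standard) (Fin.toℕ-injective (ℕ.suc-injective (begin
        suc (toℕ (A (g⁻¹ v)))                         ≡⟨ cong (suc ∘ toℕ ∘ A) (strictlyInverseˡ (g⁻¹ v)) ⟨
        suc (toℕ (A (to (from (g⁻¹ v)))))             ≡⟨ cong (λ w → suc (toℕ (A (to (from (g⁻¹ w)))))) (strictlyInverseˡ v) ⟨
        suc (toℕ (A (to (from (g⁻¹ (to (from v))))))) ≡⟨ fixes standardArrangement standardArrangement-compactMagic (from v) ⟩
        suc (toℕ (A (to (from v))))                   ≡⟨ cong (suc ∘ toℕ ∘ A) (strictlyInverseˡ v) ⟩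
        suc (toℕ (A v))                               ∎))) ⟩
      Inverse.from standard (A v)           ≡⟨ Inverse.strictlyInverseʳ standard v ⟩
      v                                     ∎

  -- With a and b carrying A and B to the standard arrangement, b⁻¹ a carries A to B.
  transitive : TransitiveOn (naturalAction φ) IsCompactMagic
  transitive A B MA MB = symᵍ b ∘ᵍ a , moves
    where
    onV : Arrangement (suc m′) → V ↔ Fin (4 ^ suc m′)
    onV A = A ↔-∘ ↔-sym (GraphIso.vertices φ)
    magic-A = proj₂ (compactMagic⇒magic φ A MA)
    magic-B = proj₂ (compactMagic⇒magic φ B MB)
    a b : GraphIso (FQ n) (FQ n)
    a = toStandard (onV A) magic-A
    b = toStandard (onV B) magic-B
    moves : ∀ p → entry (LeftAction._▷_ (naturalAction φ) (symᵍ b ∘ᵍ a) A) p ≡ entry B p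
    moves p = cong (suc ∘ toℕ) (begin
      Inverse.to (onV A) (Inverse.from (GraphIso.vertices a) w)
        ≡⟨ standard-toStandard (onV A) magic-A (Inverse.from (GraphIso.vertices a) w) ⟩
      Inverse.to standard (Inverse.to (GraphIso.vertices a) (Inverse.from (GraphIso.vertices a) w))
        ≡⟨ cong (Inverse.to standard) (Inverse.strictlyInverseˡ (GraphIso.vertices a) w) ⟩
      Inverse.to standard w
        ≡⟨ standard-toStandard (onV B) magic-B (to p) ⟨
      Inverse.to B (from (to p))
        ≡⟨ cong (Inverse.to B) (strictlyInverseʳ p) ⟩
      Inverse.to B p ∎)
      where
      w : V
      w = Inverse.to (GraphIso.vertices b) (to p)

theorem9 : (m : ℕ) → 1 ≤ m → (φ : GraphIso (C₄ □^ m) (Q (m * 2))) →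
    (Aut (FQ (m * 2)) ≅ᴳ (C₂^ (m * 2) ⋊S))
    × Stable (naturalAction φ) IsCompactMagic
    × FaithfulOn (naturalAction φ) IsCompactMagic
    × (∃[ A ] IsCompactMagic {m} A)
    × TransitiveOn (naturalAction φ) IsCompactMagic
theorem9 (suc m′) _ φ =
    FoldedCube.Aut-FQ (suc m′)
  , Magic.stable (suc m′) φ
  , faithful m′ φ
  , (standardArrangement m′ φ , standardArrangement-compactMagic m′ φ)
  , transitive m′ φ
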